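{- Let $R\subseteq\mathbb N$ be a congruence-periodic sparse predicate. Then $(F_n)$ holds for every $n\in\mathbb N^+$; that is, for every $n\in\mathbb N^+$, $d\in\mathbb N^+$, $\tilde R\subseteq^dR$, $n$-tuple $\mathbf A$ of operators all $\neq_R0$, $n$-tuple $\mathbf B$ of operators, $\square\in\{<,>\}$, and $E\in\{0,1\}$ with $E=1$ unless $\mathbf B=\mathbf F^i$ for some $1\le i\le n$, there is $\Delta_0$ such that for all $\Delta\in d\mathbb N$ with $\Delta\ge\Delta_0$ the formula $$Ex-y_2\ \square\ \mathbf B\cdot P_\Delta(x-y_1;\mathbf A,\tilde R),$$ partitioned as $(x;y_1,y_2)$ with $|x|=1$, has a strong honest definition in $(\mathbb Z,<,+,R)$.
   Context: Let $R\subseteq\mathbb N$ be infinite, enumerated increasingly as $(r_n)$; $\sigma:R\to R$ is the successor map, $\sigma^k$ its iterate. An operator on $R$ is $z\mapsto\sum_{i=0}^ma_i\sigma^i(z)$, $a_i\in\mathbb Z$. $A=_R0$: $Az=0$ for all $z\in R$; $A>_R0$ (resp. $<_R0$): $Az>0$ (resp. $<0$) for cofinitely many $z$. $R$ sparse: every operator satisfies (S1) $A=_R0$ or $A>_R0$ or $A<_R0$; (S2) if $A>_R0$ there is $\Delta$ with $A(\sigma^\Delta z)>z$ for all $z$. Congruence-periodic: $(r_n\bmod m)$ eventually periodic for each $m\ge1$. $\tilde R\subseteq^dR$: $\tilde R=\{r_{N+dt}:t\in\mathbb N\}$ for some $N$. $\mathbf A\cdot z=\sum A_iz_i$, $\mathbf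 A\cdot S=\{\mathbf A\cdot z:z\in S\}$. $\tilde R^n_\Delta=\{z\in\tilde R^n:z_i\ge\sigma^\Delta z_{i+1}\ (1\le i\le n)\}$, $z_{n+1}:=\min\tilde R$. For $\mathbf A$ with entries $\neq_R0$ and $\Delta$ large enough that $z\mapsto\mathbf A\cdot z$ is injective on $R^n_\Delta$, $P_\Delta(x;\mathbf A,\tilde R)$ is the $z\in\tilde R^n_\Delta$ with largest $\mathbf A\cdot z$ subject to $\mathbf A\cdot z<x$ if $x>\inf\mathbf A\cdot\tilde R^n_\Delta$, and otherwise the $z\in\tilde R^n_\Delta$ minimising $\mathbf A\cdot z$. $\mathbf F^i$ is the $n$-tuple with the identity operator in position $i$ and the zero operator elsewhere. A strong honest definition for $\phi(x;y)$ in $\mathcal M=(\mathbb Z,<,+,R)$ is a formula $\psi(x;y^{(1)},\dots,y^{(k)})$ such that for every $a$ and finite $B\subseteq\mathbb Z^{|y|}$, $|B|\ge2$, there is $c\in B^k$ with $\mathcal M\models\psi(a;c)$ and for all $a'\models\psi(x;c)$, $b\in B$: $\phi(a;b)\leftrightarrow\phi(a';b)$.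
   Formalization: The strong honest definition in (ℤ,<,+,R) is claimed only when R̃ is definable in that structure; for arbitrary R̃ it is given in (ℤ,<,+,R,R̃), since the literal claim fails, e.g. for R the factorials and d=2. -}

module Defs where

open import Level using (0ℓ)
open import Data.Nat as ℕ using (ℕ; suc; NonZero)
open import Data.Nat.DivMod using (_%_)
open import Data.Integer as ℤ using (ℤ; +_; 0ℤ; 1ℤ; _+_; _-_; _*_; _<_; _>_; _≤_)
open import Data.Bool using (if_then_else_)
open import Data.Fin using (Fin; suc; toℕ; _≟_)
open import Data.List using (List; []; _∷_)
open import Data.List.Membership.Propositional using (_∈_)
open import Data.Vec using (Vec; []; _∷_; _∷ʳ_; _++_; concat; lookup; tabulate)
open import Data.Product using (Σ-syntax; ∃-syntax; _×_)
open import Data.Sum using (_⊎_)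
open import Data.Empty using (⊥)
open import Function.Bundles using (_⇔_)
open import Relation.Nullary using (¬_; does)
open import Relation.Unary using (Pred)
open import Relation.Binary.PropositionalEquality using (_≡_; _≢_)

------------------------------------------------------------------------
-- Infinite subsets of ℕ, enumerated increasingly

record IncreasingEnumeration (R : Pred ℕ 0ℓ) (r : ℕ → ℕ) : Set where
  field
    increasing : ∀ n → r n ℕ.< r (suc n)
    sound      : ∀ n → R (r n)
    complete   : ∀ {z} → R z → ∃[ n ] z ≡ r n

-- The image in ℤ of a subset of ℕ.
inℤ : Pred ℕ 0ℓ → Pred ℤ 0ℓ
inℤ Q v = ∃[ z ] Q z × v ≡ + z

------------------------------------------------------------------------
-- First-order formulas, with de Bruijn variables, in the language (<, +)
-- with s further unary predicate symbols

data Term (n : ℕ) : Set where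
  var : Fin n → Term n
  _⊕_ : Term n → Term n → Term n

data Formula (s : ℕ) : ℕ → Set where
  _≐_ _≺_       : ∀ {n} → Term n → Term n → Formula s n
  pred          : ∀ {n} → Fin s → Term n → Formula s n
  ⊥̇             : ∀ {n} → Formula s n
  _∧̇_ _∨̇_ _⇒̇_   : ∀ {n} → Formula s n → Formula s n → Formula s n
  ∀̇_ ∃̇_         : ∀ {n} → Formula s (suc n) → Formula s n

-- Q₁ ∷ … ∷ Qₛ ∷ [] stands for the structure (ℤ, <, +, Q₁, …, Qₛ).
Structure : ℕ → Set₁
Structure s = Vec (Pred ℤ 0ℓ) s

⟦_⟧ : ∀ {n} → Term n → Vec ℤ n → ℤ
⟦ var i ⟧ ρ = lookup ρ i
⟦ t ⊕ u ⟧ ρ = ⟦ t ⟧ ρ + ⟦ u ⟧ ρ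

infix 3 _⊨_[_]

_⊨_[_] : ∀ {s n} → Structure s → Formula s n → Vec ℤ n → Set
𝓜 ⊨ t ≐ u    [ ρ ] = ⟦ t ⟧ ρ ≡ ⟦ u ⟧ ρ
𝓜 ⊨ t ≺ u    [ ρ ] = ⟦ t ⟧ ρ < ⟦ u ⟧ ρ
𝓜 ⊨ pred i t [ ρ ] = lookup 𝓜 i (⟦ t ⟧ ρ)
𝓜 ⊨ ⊥̇        [ ρ ] = ⊥
𝓜 ⊨ φ ∧̇ ψ    [ ρ ] = (𝓜 ⊨ φ [ ρ ]) × (𝓜 ⊨ ψ [ ρ ])
𝓜 ⊨ φ ∨̇ ψ    [ ρ ] = (𝓜 ⊨ φ [ ρ ]) ⊎ (𝓜 ⊨ ψ [ ρ ])
𝓜 ⊨ φ ⇒̇ ψ    [ ρ ] = (𝓜 ⊨ φ [ ρ ]) → (𝓜 ⊨ ψ [ ρ ])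
𝓜 ⊨ ∀̇ φ      [ ρ ] = ∀ (v : ℤ) → 𝓜 ⊨ φ [ v ∷ ρ ]
𝓜 ⊨ ∃̇ φ      [ ρ ] = ∃[ v ] 𝓜 ⊨ φ [ v ∷ ρ ]

-- Pitfall: R̃ ⊆ᵈ R need not be definable in (ℤ, <, +, R), and then a condition
-- on P_Δ(x; 𝐀, R̃) need not be a formula of that structure.  For example, with
-- R = {(n+1)! : n ∈ ℕ} and d = 2, the relation x − y₂ < P_Δ(x − y₁; 1, R̃)
-- has fibre ⋃ { (z, z+5) : z ∈ R̃ } at y = (0, 5), up to a finite set.
-- A fibre of a relation with a strong honest definition is a finite union of
-- definable sets ψ(ℤ; c), but this fibre is not definable without R̃.
Definable : ∀ {s} → Structure s → Pred ℤ 0ℓ → Set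
Definable {s} 𝓜 Q =
  Σ[ θ ∈ Formula s 1 ] (∀ v → (𝓜 ⊨ θ [ v ∷ [] ]) ⇔ Q v)

-- Only the relation that φ(x;y) defines on ℤ^p × ℤ^q matters here, so φ is
-- given as that relation; ψ is a genuine first-order formula.  A finite
-- B ⊆ ℤ^q is given by a list of its elements.
HasStrongHonestDefinition :
  ∀ {s p q} → Structure s → (Vec ℤ p → Vec ℤ q → Set) → Set
HasStrongHonestDefinition {s} {p} {q} 𝓜 φ =
  ∃[ k ] Σ[ ψ ∈ Formula s (p ℕ.+ k ℕ.* q) ]
    (∀ (a : Vec ℤ p) (B : List (Vec ℤ q)) →
     (∃[ b ] ∃[ b′ ] b ∈ B × b′ ∈ B × b ≢ b′) →
     Σ[ c ∈ Vec (Vec ℤ q) k ]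
       (∀ i → lookup c i ∈ B)
       × (𝓜 ⊨ ψ [ a ++ concat c ])
       × (∀ a′ → 𝓜 ⊨ ψ [ a′ ++ concat c ] → ∀ b → b ∈ B → φ a b ⇔ φ a′ b))

------------------------------------------------------------------------
-- Operators on R

-- The coefficients a₀, …, aₘ.
Operator : Set
Operator = List ℤ

𝟎 𝟏 : Operator
𝟎 = []
𝟏 = 1ℤ ∷ []

-- The element r n of R is represented throughout by its index n, so that σ
-- is suc and σ^Δ is Δ +_.
module OnPredicate (r : ℕ → ℕ) where

  Elem : Set
  Elem = ℕ

  val : Elem → ℤ
  val z = + r z

  σ^ : ℕ → Elem → Elem
  σ^ Δ z = Δ ℕ.+ z

  infixr 8 _⟨_⟩

  _⟨_⟩ : Operator → Elem → ℤ
  []       ⟨ z ⟩ = 0ℤ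
  (a ∷ as) ⟨ z ⟩ = a * val z + as ⟨ σ^ 1 z ⟩

  _≈_ : Operator → Operator → Set
  A ≈ B = ∀ z → A ⟨ z ⟩ ≡ B ⟨ z ⟩

  _=R0 _>R0 _<R0 : Operator → Set
  A =R0 = ∀ z → A ⟨ z ⟩ ≡ 0ℤ
  A >R0 = ∃[ k ] ∀ z → k ℕ.≤ z → A ⟨ z ⟩ > 0ℤ
  A <R0 = ∃[ k ] ∀ z → k ℕ.≤ z → A ⟨ z ⟩ < 0ℤ

  record Sparse : Set where
    field
      S1 : ∀ A → A =R0 ⊎ A >R0 ⊎ A <R0
      S2 : ∀ A → A >R0 → ∃[ Δ ] ∀ z → A ⟨ σ^ Δ z ⟩ > val z

  CongruencePeriodic : Set
  CongruencePeriodic =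
    ∀ m .{{_ : NonZero m}} →
    ∃[ k ] ∃[ p ] p ≢ 0 × (∀ n → k ℕ.≤ n → r (p ℕ.+ n) % m ≡ r n % m)

  -- Sub d N = { r_{N+dt} : t ∈ ℕ }; as N varies, these are the R̃ ⊆ᵈ R.
  Sub : ℕ → ℕ → Pred ℕ 0ℓ
  Sub d N z = ∃[ t ] z ≡ r (N ℕ.+ d ℕ.* t)

  infixl 7 _·_

  _·_ : ∀ {n} → Vec Operator n → Vec Elem n → ℤ
  []       · []       = 0ℤ
  (A ∷ As) · (z ∷ zs) = A ⟨ z ⟩ + As · zs

  -- For R̃ = Sub d N, the set R̃ⁿ_Δ.  The element z_{n+1} = min R̃ has index
  -- N and is appended to z.
  record Spaced (d N Δ : ℕ) {n : ℕ} (z : Vec Elem n) : Set where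
    field
      inSub  : ∀ i → Sub d N (r (lookup z i))
      spaced : ∀ (i : Fin n) →
        val (lookup z i) ℤ.≥
        val (σ^ Δ (lookup (z ∷ʳ N) (suc i)))

  -- z ↦ A · z is injective on Rⁿ_Δ; note that R = Sub 1 0.
  InjectiveOnSpaced : ∀ {n} → Vec Operator n → ℕ → Set
  InjectiveOnSpaced A Δ =
    ∀ z z′ → Spaced 1 0 Δ z → Spaced 1 0 Δ z′ → A · z ≡ A · z′ → z ≡ z′

  -- x > inf S (with inf S possibly −∞) means that some element of S is < x.
  AboveInf : ∀ {n} → Vec Operator n → (d N Δ : ℕ) → ℤ → Set
  AboveInf A d N Δ x = ∃[ w ] Spaced d N Δ w × A · w < x

  -- z = P_Δ(x; A, Sub d N)
  record IsP {n} (A : Vec Operator n) (d N Δ : ℕ) (x : ℤ) (z : Vec Elem n) : Set where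
    field
      member  : Spaced d N Δ z
      below   : AboveInf A d N Δ x → A · z < x
      largest : AboveInf A d N Δ x →
                ∀ w → Spaced d N Δ w → A · w < x → A · w ≤ A · z
      least   : ¬ AboveInf A d N Δ x →
                ∀ w → Spaced d N Δ w → A · z ≤ A · w

  𝐅 : ∀ {n} → Fin n → Vec Operator n
  𝐅 i = tabulate λ j → if does (i ≟ j) then 𝟏 else 𝟎

  _≋_ : ∀ {n} → Vec Operator n → Vec Operator n → Set
  A ≋ B = ∀ i → lookup A i ≈ lookup B i

  data Comparison : Set where
    less greater : Comparison

  ⟪_⟫ : Comparison → ℤ → ℤ → Set
  ⟪ less    ⟫ = _<_
  ⟪ greater ⟫ = _>_

  -- E x − y₂ □ B · P(x − y₁), partitioned as (x; y₁, y₂)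
  formula : ∀ {n} → Fin 2 → Comparison → Vec Operator n → (ℤ → Vec Elem n) →
            Vec ℤ 1 → Vec ℤ 2 → Set
  formula E □ B P (x ∷ []) (y₁ ∷ y₂ ∷ []) =
    ⟪ □ ⟫ (+ toℕ E * x - y₂) (B · P (x - y₁))

{-# OPTIONS --safe #-}
module Submission where

-- With d ∣ Δ the spaced tuples correspond to weakly decreasing tuples of
-- natural numbers, and for large Δ the value 𝐀 · z is ordered lexicographically
-- up to the signs of the operators.  Hence P_Δ(v; 𝐀, R̃) is computed greedily:
-- its leading entry L(v) is a kind of logarithm of v, and the remaining entries
-- are either extremal or P_Δ(v - A₁z₁; A₂, …, Aₙ, R̃).
--
-- Since R grows exponentially, L(v + w) differs by boundedly many steps from
-- L(v) or L(w) when v and w have the same sign.  Given a and B, let u be the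
-- nearest y₁ below (or above) a.  Then a - y₁ = (a - u) + (u - y₁), so L(a - y₁)
-- is one of finitely many functions, each of which depends on (a, u) only or
-- on (y, u) only, and after subtracting A₁L the argument is again a function
-- of (x, u) plus a function of (y, u).  By induction on n the truth of the
-- formula depends only on the signs of finitely many sums f(x, u) + g(y, u);
-- such a sign is isolated by the b in B with the extremal values of g.

-- A logarithm of a sum is controlled by the logarithms of the summands only if these have the same
-- sign, since otherwise they may cancel. This forces one nearest u for each sign of a - y₁. Which
-- of the finitely many functions then gives L(a - y₁) still depends on y. The isolating formula
-- therefore chooses none of them: for every candidate it preserves the truth value at those y where
-- the candidate is correct, and correctness is itself a matter of signs, so it passes from a to a′.
-- The induction needs a stronger statement than the theorem: the truth of 0 < T + 𝐁 · P(V) is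
-- preserved for all V and T of the form f(x, u) + g(y, u) and all definable sequences in place of
-- 𝐁. Each step puts one more pair from B into u, so the number of parameters depends on n and the
-- growth constants but not on B. As R̃ need not be definable from R, formulas are built with
-- symbols for both predicates. A definition of R̃, if there is one, is inserted at the very end.

open import Defs
open import Level using (0ℓ)
open import Algebra.Bundles using (module AbelianGroup)
open import Data.Bool using (Bool; true; false)
open import Data.Nat as ℕ using (ℕ; zero; suc; NonZero)
import Data.Nat.Properties as ℕ
open import Data.Nat.Divisibility using (_∣_; divides)
import Data.Nat.Tactic.RingSolver as ℕ-solver
open import Data.Integer as ℤ using (ℤ; +_; -[1+_]; 0ℤ; 1ℤ; -1ℤ; _+_; _-_; -_; _*_; _<_; _≤_; ∣_∣)
import Data.Integer.Properties as ℤ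
open import Data.Integer.Tactic.RingSolver using (solve-∀)
open import Algebra.Properties.Group (AbelianGroup.group ℤ.+-0-abelianGroup)
  using (identityʳ-unique; inverseˡ-unique)
open import Data.Fin using (Fin; zero; suc; toℕ; lift; _↑ˡ_; _↑ʳ_)
open import Data.Fin.Patterns
open import Data.List using (List; []; _∷_)
open import Data.List.Membership.Propositional using (_∈_)
open import Data.List.Relation.Unary.Any using (here; there)
open import Data.Vec using (Vec; []; _∷_; _∷ʳ_; _++_; concat; lookup; tabulate; tail)
open import Data.Vec.Properties using (lookup-++ˡ; lookup-++ʳ; lookup∘tabulate)
open import Data.Vec.Relation.Unary.All using (All; []; _∷_)
open import Data.Vec.Relation.Unary.All.Properties using (++⁺; lookup⁺)
open import Data.Product using (Σ-syntax; ∃-syntax; _×_; _,_; proj₁; proj₂)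
open import Data.Product.Function.NonDependent.Propositional using (_×-⇔_)
open import Data.Sum using (_⊎_; inj₁; inj₂)
open import Data.Sum.Function.Propositional using (_⊎-⇔_)
open import Data.Empty using (⊥-elim)
open import Data.Unit using (⊤; tt)
open import Function using (_∘_; id)
open import Function.Bundles using (_⇔_; mk⇔; module Equivalence)
open import Function.Construct.Composition using (_⇔-∘_)
open import Function.Construct.Identity using (⇔-id)
open import Function.Construct.Symmetry using (⇔-sym)
open import Function.Related.TypeIsomorphisms using (→-cong-⇔)
open import Relation.Nullary using (¬_; Dec; yes; no)
open import Relation.Nullary.Decidable using (_⊎-dec_)
open import Relation.Unary using (Pred)
open import Relation.Binary using (tri<; tri≈; tri>)
open import Relation.Binary.PropositionalEquality
  using (_≡_; _≢_; refl; sym; trans; cong; cong₂; subst; subst₂)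

open Equivalence using (to; from)


-- Renaming of variables and replacement of predicate symbols

∀-⇔ : {X : Set} {P Q : X → Set} → (∀ x → P x ⇔ Q x) → (∀ x → P x) ⇔ (∀ x → Q x)
∀-⇔ h = mk⇔ (λ p x → to (h x) (p x)) (λ q x → from (h x) (q x))

∃-⇔ : {X : Set} {P Q : X → Set} → (∀ x → P x ⇔ Q x) → (∃[ x ] P x) ⇔ (∃[ x ] Q x)
∃-⇔ h = mk⇔ (λ (x , p) → x , to (h x) p) (λ (x , q) → x , from (h x) q)

≡⇒⇔ : {P Q : Set} → P ≡ Q → P ⇔ Q
≡⇒⇔ refl = ⇔-id _

renameₜ : ∀ {m n} → (Fin m → Fin n) → Term m → Term n
renameₜ f (var i) = var (f i)
renameₜ f (t ⊕ u) = renameₜ f t ⊕ renameₜ f u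

rename : ∀ {s m n} → (Fin m → Fin n) → Formula s m → Formula s n
rename f (t ≐ u)    = renameₜ f t ≐ renameₜ f u
rename f (t ≺ u)    = renameₜ f t ≺ renameₜ f u
rename f (pred i t) = pred i (renameₜ f t)
rename f ⊥̇          = ⊥̇
rename f (φ ∧̇ ψ)    = rename f φ ∧̇ rename f ψ
rename f (φ ∨̇ ψ)    = rename f φ ∨̇ rename f ψ
rename f (φ ⇒̇ ψ)    = rename f φ ⇒̇ rename f ψ
rename f (∀̇ φ)      = ∀̇ rename (lift 1 f) φ
rename f (∃̇ φ)      = ∃̇ rename (lift 1 f) φ

Agrees : ∀ {m n} → (Fin m → Fin n) → Vec ℤ m → Vec ℤ n → Set
Agrees f ρ σ = ∀ i → lookup σ (f i) ≡ lookup ρ i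

agrees-lift : ∀ {m n} {f : Fin m → Fin n} {ρ σ} → Agrees f ρ σ →
              ∀ v → Agrees (lift 1 f) (v ∷ ρ) (v ∷ σ)
agrees-lift h v zero    = refl
agrees-lift h v (suc i) = h i

⟦⟧-renameₜ : ∀ {m n} {f : Fin m → Fin n} {ρ σ} → Agrees f ρ σ →
             ∀ t → ⟦ t ⟧ ρ ≡ ⟦ renameₜ f t ⟧ σ
⟦⟧-renameₜ h (var i) = sym (h i)
⟦⟧-renameₜ h (t ⊕ u) = cong₂ _+_ (⟦⟧-renameₜ h t) (⟦⟧-renameₜ h u)

⊨-rename : ∀ {s m n} (𝓜 : Structure s) {f : Fin m → Fin n} {ρ σ} → Agrees f ρ σ →
           ∀ φ → (𝓜 ⊨ φ [ ρ ]) ⇔ (𝓜 ⊨ rename f φ [ σ ])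
⊨-rename 𝓜 h (t ≐ u)    = ≡⇒⇔ (cong₂ _≡_ (⟦⟧-renameₜ h t) (⟦⟧-renameₜ h u))
⊨-rename 𝓜 h (t ≺ u)    = ≡⇒⇔ (cong₂ _<_ (⟦⟧-renameₜ h t) (⟦⟧-renameₜ h u))
⊨-rename 𝓜 h (pred i t) = ≡⇒⇔ (cong (lookup 𝓜 i) (⟦⟧-renameₜ h t))
⊨-rename 𝓜 h ⊥̇          = ⇔-id _
⊨-rename 𝓜 h (φ ∧̇ ψ)    = ⊨-rename 𝓜 h φ ×-⇔ ⊨-rename 𝓜 h ψ
⊨-rename 𝓜 h (φ ∨̇ ψ)    = ⊨-rename 𝓜 h φ ⊎-⇔ ⊨-rename 𝓜 h ψ
⊨-rename 𝓜 h (φ ⇒̇ ψ)    = →-cong-⇔ (⊨-rename 𝓜 h φ) (⊨-rename 𝓜 h ψ)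
⊨-rename 𝓜 h (∀̇ φ)      = ∀-⇔ λ v → ⊨-rename 𝓜 (agrees-lift h v) φ
⊨-rename 𝓜 h (∃̇ φ)      = ∃-⇔ λ v → ⊨-rename 𝓜 (agrees-lift h v) φ

replace : ∀ {s s′ n} → (Fin s → Formula s′ 1) → Formula s n → Formula s′ n
replace θ (t ≐ u)    = t ≐ u
replace θ (t ≺ u)    = t ≺ u
-- Terms are not substituted into `θ i`: a quantifier names the value of `t`, and a renaming sends
-- the only variable of `θ i` to that name.
replace θ (pred i t) = ∃̇ ((var 0F ≐ renameₜ suc t) ∧̇ rename (λ _ → 0F) (θ i))
replace θ ⊥̇          = ⊥̇
replace θ (φ ∧̇ ψ)    = replace θ φ ∧̇ replace θ ψ
replace θ (φ ∨̇ ψ)    = replace θ φ ∨̇ replace θ ψ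
replace θ (φ ⇒̇ ψ)    = replace θ φ ⇒̇ replace θ ψ
replace θ (∀̇ φ)      = ∀̇ replace θ φ
replace θ (∃̇ φ)      = ∃̇ replace θ φ

⊨-replace : ∀ {s s′ n} (𝓜 : Structure s) (𝓝 : Structure s′) (θ : Fin s → Formula s′ 1) →
            (∀ i v → (𝓝 ⊨ θ i [ v ∷ [] ]) ⇔ lookup 𝓜 i v) →
            ∀ (φ : Formula s n) ρ → (𝓜 ⊨ φ [ ρ ]) ⇔ (𝓝 ⊨ replace θ φ [ ρ ])
⊨-replace 𝓜 𝓝 θ h (t ≐ u)    ρ = ⇔-id _
⊨-replace 𝓜 𝓝 θ h (t ≺ u)    ρ = ⇔-id _
⊨-replace 𝓜 𝓝 θ h (pred i t) ρ = mk⇔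
  (λ p → _ , ⟦⟧-renameₜ (λ _ → refl) t , to (θ-at _) (from (h i _) p))
  (λ (v , v≡t , q) → subst (lookup 𝓜 i) (trans v≡t (sym (⟦⟧-renameₜ (λ _ → refl) t)))
                       (to (h i v) (from (θ-at v) q)))
  where
  θ-at : ∀ v → (𝓝 ⊨ θ i [ v ∷ [] ]) ⇔ (𝓝 ⊨ rename (λ _ → 0F) (θ i) [ v ∷ ρ ])
  θ-at v = ⊨-rename 𝓝 (λ { zero → refl }) (θ i)
⊨-replace 𝓜 𝓝 θ h ⊥̇          ρ = ⇔-id _
⊨-replace 𝓜 𝓝 θ h (φ ∧̇ ψ)    ρ = ⊨-replace 𝓜 𝓝 θ h φ ρ ×-⇔ ⊨-replace 𝓜 𝓝 θ h ψ ρ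
⊨-replace 𝓜 𝓝 θ h (φ ∨̇ ψ)    ρ = ⊨-replace 𝓜 𝓝 θ h φ ρ ⊎-⇔ ⊨-replace 𝓜 𝓝 θ h ψ ρ
⊨-replace 𝓜 𝓝 θ h (φ ⇒̇ ψ)    ρ = →-cong-⇔ (⊨-replace 𝓜 𝓝 θ h φ ρ) (⊨-replace 𝓜 𝓝 θ h ψ ρ)
⊨-replace 𝓜 𝓝 θ h (∀̇ φ)      ρ = ∀-⇔ λ v → ⊨-replace 𝓜 𝓝 θ h φ (v ∷ ρ)
⊨-replace 𝓜 𝓝 θ h (∃̇ φ)      ρ = ∃-⇔ λ v → ⊨-replace 𝓜 𝓝 θ h φ (v ∷ ρ)

-- Definable relations and functions

-- The coordinates e let the points range over any type X, in particular over
-- indices t ∈ ℕ that stand for the element e t of a unary predicate.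
module Definability {s : ℕ} (𝓜 : Structure s) where

  Def : ∀ {X : Set} {n} → (X → Vec ℤ n) → (X → Set) → Set
  Def {n = n} e Q = Σ[ θ ∈ Formula s n ] (∀ x → (𝓜 ⊨ θ [ e x ]) ⇔ Q x)

  infixr 5 _∷∙_

  _∷∙_ : ∀ {Y X : Set} {n} → (Y → ℤ) → (X → Vec ℤ n) → Y × X → Vec ℤ (suc n)
  (e₀ ∷∙ e) (y , x) = e₀ y ∷ e x

  -- Terms are built with + only, so a function enters a formula through its graph, the value being
  -- the new variable 0.
  DefFun : ∀ {X : Set} {n} → (X → Vec ℤ n) → (X → ℤ) → Set
  DefFun e f = Def (id ∷∙ e) λ (w , x) → w ≡ f x

  module _ {X : Set} {n} {e : X → Vec ℤ n} where

    Def-cong : ∀ {P Q} → (∀ x → P x ⇔ Q x) → Def e P → Def e Q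
    Def-cong h (θ , θ-def) = θ , λ x → h x ⇔-∘ θ-def x

    DefFun-cong : ∀ {f g} → (∀ x → f x ≡ g x) → DefFun e f → DefFun e g
    DefFun-cong h (θ , θ-def) = θ , λ (w , x) → ≡⇒⇔ (cong (w ≡_) (h x)) ⇔-∘ θ-def (w , x)

    infixr 6 _∧ᵈ_
    infixr 5 _∨ᵈ_
    infixr 4 _⇒ᵈ_

    _∧ᵈ_ : ∀ {P Q} → Def e P → Def e Q → Def e λ x → P x × Q x
    (φ , p) ∧ᵈ (ψ , q) = φ ∧̇ ψ , λ x → p x ×-⇔ q x

    _∨ᵈ_ : ∀ {P Q} → Def e P → Def e Q → Def e λ x → P x ⊎ Q x
    (φ , p) ∨ᵈ (ψ , q) = φ ∨̇ ψ , λ x → p x ⊎-⇔ q x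

    _⇒ᵈ_ : ∀ {P Q} → Def e P → Def e Q → Def e λ x → P x → Q x
    (φ , p) ⇒ᵈ (ψ , q) = φ ⇒̇ ψ , λ x → →-cong-⇔ (p x) (q x)

    ¬ᵈ : ∀ {P} → Def e P → Def e λ x → ¬ P x
    ¬ᵈ (φ , p) = φ ⇒̇ ⊥̇ , λ x → →-cong-⇔ (p x) (⇔-id _)

    ∀ᵈ : ∀ {Q} → Def (id ∷∙ e) Q → Def e λ x → ∀ v → Q (v , x)
    ∀ᵈ (φ , p) = ∀̇ φ , λ x → ∀-⇔ λ v → p (v , x)

    ∃ᵈ : ∀ {Q} → Def (id ∷∙ e) Q → Def e λ x → ∃[ v ] Q (v , x)
    ∃ᵈ (φ , p) = ∃̇ φ , λ x → ∃-⇔ λ v → p (v , x)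

    varᵈ : ∀ i → DefFun e λ x → lookup (e x) i
    varᵈ i = var 0F ≐ var (suc i) , λ _ → ⇔-id _

  reindex : ∀ {X Y : Set} {m n} {e : X → Vec ℤ m} {e′ : Y → Vec ℤ n} {Q} (g : Y → X)
            (f : Fin m → Fin n) → (∀ y → Agrees f (e (g y)) (e′ y)) →
            Def e Q → Def e′ (Q ∘ g)
  reindex g f h (θ , θ-def) = rename f θ , λ y → θ-def (g y) ⇔-∘ ⇔-sym (⊨-rename 𝓜 (h y) θ)

  weaken : ∀ {X : Set} {n} {e : X → Vec ℤ n} {Y : Set} {e₀ : Y → ℤ} {f} →
           DefFun e f → DefFun (e₀ ∷∙ e) (f ∘ proj₂)
  weaken = reindex (λ (w , _ , x) → w , x) (lift 1 suc)
             λ { _ zero → refl ; _ (suc _) → refl }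

  -- The functions f i are bound one after the other by existential
  -- quantifiers, the remaining ones being shifted past the new variable.
  simultaneous : ∀ {X : Set} {n} {e : X → Vec ℤ n} k (f : Fin k → X → ℤ) →
                 (∀ i → DefFun e (f i)) → (φ : Formula s (k ℕ.+ n)) →
                 Def e λ x → 𝓜 ⊨ φ [ tabulate (λ i → f i x) ++ e x ]
  simultaneous zero    f d φ = φ , λ _ → ⇔-id _
  simultaneous {e = e} (suc k) f d φ =
    Def-cong (λ x → mk⇔ (λ (w , p , q) → subst (λ w → 𝓜 ⊨ φ [ w ∷ rest x ++ e x ]) (to (θ-at w x) p) q)
                        (λ q → f zero x , from (θ-at _ x) refl , q))
      (simultaneous k (f ∘ suc) (d ∘ suc) (∃̇ (rename (lift 1 (k ↑ʳ_)) (proj₁ (d zero)) ∧̇ φ)))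
    where
    rest : _ → Vec ℤ k
    rest x = tabulate (λ i → f (suc i) x)
    θ-at : ∀ w x → (𝓜 ⊨ rename (lift 1 (k ↑ʳ_)) (proj₁ (d zero)) [ w ∷ rest x ++ e x ]) ⇔ (w ≡ f zero x)
    θ-at w x = proj₂ (d zero) (w , x) ⇔-∘
      ⇔-sym (⊨-rename 𝓜 (agrees-lift (lookup-++ʳ (rest x) (e x)) w) (proj₁ (d zero)))

  substitute : ∀ {X Y : Set} {m n} {e : X → Vec ℤ m} {e′ : Y → Vec ℤ n} {Q} (g : Y → X) →
               (∀ i → DefFun e′ λ y → lookup (e (g y)) i) → Def e Q → Def e′ (Q ∘ g)
  substitute {m = m} {n} {e} {e′} g d (θ , θ-def) =
    Def-cong (λ y → θ-def (g y) ⇔-∘ ⇔-sym (⊨-rename 𝓜 (agrees y) θ))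
      (simultaneous m (λ i y → lookup (e (g y)) i) d (rename (_↑ˡ n) θ))
    where
    agrees : ∀ y → Agrees (_↑ˡ n) (e (g y)) (tabulate (lookup (e (g y))) ++ e′ y)
    agrees y i = trans (lookup-++ˡ (tabulate (lookup (e (g y)))) (e′ y) i)
                       (lookup∘tabulate (lookup (e (g y))) i)

  compose : ∀ {X Y : Set} {m n} {e : X → Vec ℤ m} {e′ : Y → Vec ℤ n} {F} (g : Y → X) →
            (∀ i → DefFun e′ λ y → lookup (e (g y)) i) → DefFun e F → DefFun e′ (F ∘ g)
  compose g d = substitute (λ (w , y) → w , g y) λ { zero → varᵈ zero ; (suc i) → weaken (d i) }

  module _ {X : Set} {n} {e : X → Vec ℤ n} where

    infix  7 _<ᵈ_ _≡ᵈ_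
    infixl 8 _+ᵈ_

    _<ᵈ_ : ∀ {f g} → DefFun e f → DefFun e g → Def e λ x → f x < g x
    d <ᵈ d′ = substitute {e = id ∷∙ id ∷∙ λ (_ : ⊤) → []} (λ x → _ , _ , tt)
      (λ { 0F → d ; 1F → d′ }) (var 0F ≺ var 1F , λ _ → ⇔-id _)

    _≡ᵈ_ : ∀ {f g} → DefFun e f → DefFun e g → Def e λ x → f x ≡ g x
    d ≡ᵈ d′ = substitute {e = id ∷∙ id ∷∙ λ (_ : ⊤) → []} (λ x → _ , _ , tt)
      (λ { 0F → d ; 1F → d′ }) (var 0F ≐ var 1F , λ _ → ⇔-id _)

    _+ᵈ_ : ∀ {f g} → DefFun e f → DefFun e g → DefFun e λ x → f x + g x
    d +ᵈ d′ = substitute {e = id ∷∙ id ∷∙ id ∷∙ λ (_ : ⊤) → []} (λ (w , x) → w , _ , _ , tt)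
      (λ { 0F → varᵈ zero ; 1F → weaken d ; 2F → weaken d′ })
      (var 0F ≐ (var 1F ⊕ var 2F) , λ _ → ⇔-id _)

  module _ {X : Set} {n} {e : X → Vec ℤ n} where

    -- The language has no constants: 0 is the only w with w + w = w, and 1 is then the least
    -- positive element.
    0ᵈ : DefFun e λ _ → 0ℤ
    0ᵈ = (var 0F ⊕ var 0F) ≐ var 0F , λ (w , _) → mk⇔ (identityʳ-unique w w) λ { refl → refl }

    1ᵈ : DefFun e λ _ → 1ℤ
    1ᵈ = Def-cong (λ (w , _) → mk⇔ (least w) λ { refl → ℤ.+<+ ℕ.z<s , λ v 0<v → ℤ.≤⇒≯ (ℤ.i<j⇒suc[i]≤j 0<v) })
           (wk0 <ᵈ varᵈ 0F ∧ᵈ ∀ᵈ (wk0′ <ᵈ varᵈ 0F ⇒ᵈ ¬ᵈ (varᵈ 0F <ᵈ varᵈ 1F)))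
      where
      wk0 : DefFun (id ∷∙ e) λ _ → 0ℤ
      wk0 = weaken 0ᵈ
      wk0′ : DefFun (id ∷∙ id ∷∙ e) λ _ → 0ℤ
      wk0′ = weaken wk0
      least : ∀ w → (0ℤ < w) × (∀ v → 0ℤ < v → ¬ v < w) → w ≡ 1ℤ
      least w (0<w , w-least) = ℤ.≤-antisym (ℤ.≮⇒≥ (w-least 1ℤ (ℤ.+<+ ℕ.z<s))) (ℤ.i<j⇒suc[i]≤j 0<w)

    negᵈ : ∀ {f} → DefFun e f → DefFun e λ x → - f x
    negᵈ {f} d = Def-cong (λ (w , x) → mk⇔ (λ h → inverseˡ-unique w (f x) h) λ { refl → ℤ.+-inverseˡ (f x) })
      (varᵈ 0F +ᵈ weaken d ≡ᵈ weaken 0ᵈ)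

    infixr 9 _*ᵈ_

    _*ᵈ_ : ∀ {f} c → DefFun e f → DefFun e λ x → c * f x
    _*ᵈ_ {f} (+ n) d = natMul n
      where
      natMul : ∀ n → DefFun e λ x → + n * f x
      natMul zero    = DefFun-cong (λ x → sym (ℤ.*-zeroˡ (f x))) 0ᵈ
      natMul (suc n) = DefFun-cong (λ x → sym (ℤ.suc-* (+ n) (f x))) (d +ᵈ natMul n)
    _*ᵈ_ {f} -[1+ n ] d = DefFun-cong (λ x → ℤ.neg-distribˡ-* (+ suc n) (f x)) (negᵈ ((+ suc n) *ᵈ d))

    constᵈ : ∀ c → DefFun e λ _ → c
    constᵈ c = DefFun-cong (λ _ → ℤ.*-identityʳ c) (c *ᵈ 1ᵈ)

    infixl 8 _-ᵈ_

    _-ᵈ_ : ∀ {f g} → DefFun e f → DefFun e g → DefFun e λ x → f x - g x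
    d -ᵈ d′ = d +ᵈ negᵈ d′

  module Indexed (i : Fin s) (e₀ : ℕ → ℤ) (e₀-mono : ∀ {t t′} → t ℕ.< t′ → e₀ t < e₀ t′)
                 (range : ∀ v → lookup 𝓜 i v ⇔ (∃[ t ] v ≡ e₀ t)) where

    DefIndex : ∀ {X : Set} {n} → (X → Vec ℤ n) → (X → ℕ) → Set
    DefIndex e f = DefFun e (e₀ ∘ f)

    e₀-reflects : ∀ {t t′} → e₀ t < e₀ t′ → t ℕ.< t′
    e₀-reflects {t} {t′} lt with ℕ.<-cmp t t′
    ... | tri< t<t′ _ _ = t<t′
    ... | tri≈ _ refl _ = ⊥-elim (ℤ.<-irrefl refl lt)
    ... | tri> _ _ t′<t = ⊥-elim (ℤ.<-asym lt (e₀-mono t′<t))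

    e₀-injective : ∀ {t t′} → e₀ t ≡ e₀ t′ → t ≡ t′
    e₀-injective {t} {t′} eq with ℕ.<-cmp t t′
    ... | tri< t<t′ _ _ = ⊥-elim (ℤ.<-irrefl eq (e₀-mono t<t′))
    ... | tri≈ _ t≡t′ _ = t≡t′
    ... | tri> _ _ t′<t = ⊥-elim (ℤ.<-irrefl (sym eq) (e₀-mono t′<t))

    module _ {X : Set} {n} {e : X → Vec ℤ n} where

      inRange : Def (id ∷∙ e) λ (w , _) → ∃[ t ] w ≡ e₀ t
      inRange = pred i (var 0F) , λ (w , _) → range w

      ∀ⁱ : ∀ {Q} → Def (e₀ ∷∙ e) Q → Def e λ x → ∀ t → Q (t , x)
      ∀ⁱ (θ , θ-def) = Def-cong
        (λ x → mk⇔ (λ h t → to (θ-def (t , x)) (h (e₀ t) (t , refl)))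
                   (λ { h _ (t , refl) → from (θ-def (t , x)) (h t) }))
        (∀ᵈ (inRange ⇒ᵈ (θ , λ _ → ⇔-id _)))

      ∃ⁱ : ∀ {Q} → Def (e₀ ∷∙ e) Q → Def e λ x → ∃[ t ] Q (t , x)
      ∃ⁱ (θ , θ-def) = Def-cong
        (λ x → mk⇔ (λ { (_ , (t , refl) , p) → t , to (θ-def (t , x)) p })
                   (λ (t , q) → e₀ t , (t , refl) , from (θ-def (t , x)) q))
        (∃ᵈ (inRange ∧ᵈ (θ , λ _ → ⇔-id _)))

      infix 7 _<ⁱ_ _≡ⁱ_

      _<ⁱ_ : ∀ {f g} → DefIndex e f → DefIndex e g → Def e λ x → f x ℕ.< g x
      d <ⁱ d′ = Def-cong (λ _ → mk⇔ e₀-reflects e₀-mono) (d <ᵈ d′)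

      _≡ⁱ_ : ∀ {f g} → DefIndex e f → DefIndex e g → Def e λ x → f x ≡ g x
      d ≡ⁱ d′ = Def-cong (λ _ → mk⇔ e₀-injective (cong e₀)) (d ≡ᵈ d′)

      varⁱ : DefIndex (e₀ ∷∙ e) proj₁
      varⁱ = varᵈ 0F

    module _ {X : Set} {n} {e : X → Vec ℤ n} where

      fromGraph : ∀ {f} → Def (e₀ ∷∙ e) (λ (t , x) → t ≡ f x) → DefIndex e f
      fromGraph d = Def-cong (λ (w , x) → mk⇔ (λ { (t , refl , refl) → refl }) (λ { refl → _ , refl , refl }))
        (∃ⁱ (varᵈ 1F ≡ᵈ varⁱ ∧ᵈ reindex (λ (t , _ , x) → t , x) (lift 1 suc)
               (λ { _ zero → refl ; _ (suc _) → refl }) d))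

      constⁱ : ∀ t → DefIndex e λ _ → t
      constⁱ t = constᵈ (e₀ t)

    module _ {X : Set} {n} {e : X → Vec ℤ n} where

      -- As the enumeration is increasing, the next index is the least larger one, and a quantifier
      -- over indices is a quantifier over the predicate.
      sucⁱ : ∀ {f} → DefIndex e f → DefIndex e λ x → suc (f x)
      sucⁱ {f} d = fromGraph (Def-cong
        (λ (t , x) → mk⇔ (λ (f<t , t-least) → ℕ.≤-antisym (ℕ.≮⇒≥ (t-least _ ℕ.≤-refl)) f<t)
                         (λ { refl → ℕ.≤-refl , λ t′ f<t′ t′<t → ℕ.<-irrefl refl (ℕ.<-≤-trans t′<t f<t′) }))
        (weaken d <ⁱ varⁱ ∧ᵈ ∀ⁱ (weaken (weaken d) <ⁱ varⁱ ⇒ᵈ ¬ᵈ (varⁱ <ⁱ varᵈ 1F))))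

    addⁱ : ∀ {X : Set} {n} {e : X → Vec ℤ n} {f} k → DefIndex e f → DefIndex e λ x → k ℕ.+ f x
    addⁱ zero    d = d
    addⁱ (suc k) d = sucⁱ (addⁱ k d)

    predⁱ : ∀ {X : Set} {n} {e : X → Vec ℤ n} {f} → DefIndex e f → DefIndex e λ x → ℕ.pred (f x)
    predⁱ {f = f} d = fromGraph (Def-cong
      (λ (t , x) → mk⇔ (λ { (inj₁ eq) → cong ℕ.pred eq ; (inj₂ (refl , p)) → trans p (sym (cong ℕ.pred p)) })
                       (graph t (f x)))
      (sucⁱ varⁱ ≡ⁱ weaken d ∨ᵈ varⁱ ≡ⁱ weaken d ∧ᵈ weaken d ≡ⁱ constⁱ 0))
      where
      graph : ∀ t s → t ≡ ℕ.pred s → (suc t ≡ s) ⊎ (t ≡ s) × (s ≡ 0)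
      graph t zero    refl = inj₂ (refl , refl)
      graph t (suc s) refl = inj₁ refl

-- Order on ℤ

private
  shift : ∀ p a → p + (a - p) ≡ a
  shift = solve-∀

  unshift : ∀ q p a → q + (a - p) ≡ (q - p) + a
  unshift = solve-∀

  cancel : ∀ b a → (b - a) + a ≡ b
  cancel = solve-∀

-- Rearranging an inequality is reduced to an identity between differences, which the ring solver
-- proves.
<-difference : ∀ {a b p q} → q - p ≡ b - a → p < q → a < b
<-difference {a} {b} {p} {q} eq p<q = subst₂ _<_ (shift p a)
  (trans (unshift q p a) (trans (cong (_+ a) eq) (cancel b a))) (ℤ.+-monoˡ-< (a - p) p<q)

≤-difference : ∀ {a b p q} → q - p ≡ b - a → p ≤ q → a ≤ b
≤-difference {a} {b} {p} {q} eq p≤q = subst₂ _≤_ (shift p a)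
  (trans (unshift q p a) (trans (cong (_+ a) eq) (cancel b a))) (ℤ.+-monoˡ-≤ (a - p) p≤q)

≤+∣∣ : ∀ i → i ≤ + ∣ i ∣
≤+∣∣ (+ n)    = ℤ.≤-refl
≤+∣∣ -[1+ n ] = ℤ.-≤+

<⇒+1≤ : ∀ {a b} → a < b → a + 1ℤ ≤ b
<⇒+1≤ {a} {b} a<b = subst (_≤ b) (ℤ.+-comm 1ℤ a) (ℤ.i<j⇒suc[i]≤j a<b)

+1≤⇒< : ∀ {a b} → a + 1ℤ ≤ b → a < b
+1≤⇒< {a} {b} h = ℤ.suc[i]≤j⇒i<j (subst (_≤ b) (ℤ.+-comm a 1ℤ) h)

-- Sums of sequences over weakly decreasing tuples

Seq : Set
Seq = ℕ → ℤ

eval : ∀ {n} → Vec Seq n → Vec ℕ n → ℤ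
eval []       []       = 0ℤ
eval (F ∷ Fs) (t ∷ ts) = F t + eval Fs ts

Below : ∀ {n} → ℕ → Vec ℕ n → Set
Below s []       = ⊤
Below s (t ∷ ts) = t ℕ.≤ s × Below t ts

Desc : ∀ {n} → Vec ℕ n → Set
Desc []       = ⊤
Desc (t ∷ ts) = Below t ts

Below⇒Desc : ∀ {n s} (ts : Vec ℕ n) → Below s ts → Desc ts
Below⇒Desc []       _       = tt
Below⇒Desc (t ∷ ts) (_ , b) = b

Below-0-unique : ∀ {n} (ts us : Vec ℕ n) → Below 0 ts → Below 0 us → ts ≡ us
Below-0-unique []          []          _         _         = refl
Below-0-unique (zero ∷ ts) (zero ∷ us) (_ , b)   (_ , b′)  = cong (0 ∷_) (Below-0-unique ts us b b′)

sgn : Bool → ℤ → ℤ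
sgn true  x = x
sgn false x = - x

sgn-+ : ∀ ε x y → sgn ε (x + y) ≡ sgn ε x + sgn ε y
sgn-+ true  x y = refl
sgn-+ false x y = ℤ.neg-distrib-+ x y

-- A larger entry moves the value in direction ε. The optimum in direction τ is thus the upper bound
-- if the two agree, and 0 if they do not.
pick : Bool → Bool → ℕ → ℕ
pick true  true  s = s
pick true  false s = 0
pick false true  s = 0
pick false false s = s

pick≤ : ∀ τ ε s → pick τ ε s ℕ.≤ s
pick≤ true  true  s = ℕ.≤-refl
pick≤ true  false s = ℕ.z≤n
pick≤ false true  s = ℕ.z≤n
pick≤ false false s = ℕ.≤-refl

-- Among the weakly decreasing tuples bounded by s, the one of largest
-- (τ = true) or smallest (τ = false) value, when εs are the signs of the
-- sequences.
extreme : ∀ {n} → Bool → Vec Bool n → ℕ → Vec ℕ n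
extreme τ []       s = []
extreme τ (ε ∷ εs) s = pick τ ε s ∷ extreme τ εs (pick τ ε s)

extreme-Below : ∀ {n} τ (εs : Vec Bool n) s → Below s (extreme τ εs s)
extreme-Below τ []       s = tt
extreme-Below τ (ε ∷ εs) s = pick≤ τ ε s , extreme-Below τ εs _

least-value : ∀ {n} → Vec Bool n → Seq → Vec Seq n → Seq
least-value εs F Fs t = F t + eval Fs (extreme false εs t)

-- The first entry of the tuple of largest value below v exceeds t exactly if
-- sgn ε v exceeds the threshold at t.
threshold : ∀ {n} → Bool → Vec Bool n → Seq → Vec Seq n → Seq
threshold true  εs F Fs t = least-value εs F Fs (suc t)
threshold false εs F Fs t = - least-value εs F Fs t - 1ℤ

-- `lex` lets the first entry decide comparisons, `nonneg` gives nonpositive numbers the logarithm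
-- 0, and `double` is exponential growth: K steps at least double the threshold. The computation of
-- P and the estimate for L(v + w) rest on these facts about the operators.
record Layer {n} (ε : Bool) (εs : Vec Bool n) (F : Seq) (Fs : Vec Seq n) : Set where
  field
    lex : ∀ {t t′} (ts ts′ : Vec ℕ n) → t ℕ.< t′ → Below t ts → Below t′ ts′ →
          sgn ε (F t + eval Fs ts) < sgn ε (F t′ + eval Fs ts′)
    nonneg : ∀ t → 0ℤ ≤ threshold ε εs F Fs t
    K      : ℕ
    double : ∀ t → threshold ε εs F Fs t + threshold ε εs F Fs t ≤ threshold ε εs F Fs (K ℕ.+ t)

data Layers : ∀ {n} → Vec Bool n → Vec Seq n → Set where
  []  : Layers [] []
  _∷_ : ∀ {n ε F} {εs : Vec Bool n} {Fs} → Layer ε εs F Fs → Layers εs Fs → Layers (ε ∷ εs) (F ∷ Fs)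

-- By `lex`, a first entry other than the picked one is worse whatever follows; equal first entries
-- leave the comparison to the tails.
eval-extreme : ∀ {n} τ {εs : Vec Bool n} {Fs} → Layers εs Fs → ∀ {s} ts → Below s ts →
               sgn τ (eval Fs ts) ≤ sgn τ (eval Fs (extreme τ εs s))
eval-extreme τ [] [] _ = ℤ.≤-refl
eval-extreme τ {ε ∷ εs} {F ∷ Fs} (l ∷ ls) {s} (t ∷ ts) (t≤s , b) = compare τ ε l
  where
  same-head : ∀ τ {p} → t ≡ p → sgn τ (F t + eval Fs ts) ≤ sgn τ (F p + eval Fs (extreme τ εs p))
  same-head τ {p} refl = subst₂ _≤_ (sym (sgn-+ τ _ _)) (sym (sgn-+ τ _ _))
    (ℤ.+-monoʳ-≤ (sgn τ (F p)) (eval-extreme τ ls ts b))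
  compare : ∀ τ ε → Layer ε εs F Fs → sgn τ (F t + eval Fs ts) ≤
            sgn τ (F (pick τ ε s) + eval Fs (extreme τ εs (pick τ ε s)))
  compare true true l with ℕ.m≤n⇒m<n∨m≡n t≤s
  ... | inj₁ t<s = ℤ.<⇒≤ (Layer.lex l ts _ t<s b (extreme-Below true εs s))
  ... | inj₂ t≡s = same-head true t≡s
  compare false false l with ℕ.m≤n⇒m<n∨m≡n t≤s
  ... | inj₁ t<s = ℤ.<⇒≤ (Layer.lex l ts _ t<s b (extreme-Below false εs s))
  ... | inj₂ t≡s = same-head false t≡s
  compare true false l with ℕ.m≤n⇒m<n∨m≡n (ℕ.z≤n {t})
  ... | inj₁ 0<t = ℤ.<⇒≤ (ℤ.neg-cancel-< (Layer.lex l _ ts 0<t (extreme-Below true εs 0) b))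
  ... | inj₂ 0≡t = same-head true (sym 0≡t)
  compare false true l with ℕ.m≤n⇒m<n∨m≡n (ℕ.z≤n {t})
  ... | inj₁ 0<t = ℤ.<⇒≤ (ℤ.neg-mono-< (Layer.lex l _ ts 0<t (extreme-Below false εs 0) b))
  ... | inj₂ 0≡t = same-head false (sym 0≡t)

module _ {n} {εs : Vec Bool n} {Fs} (ls : Layers εs Fs) where

  ≥-extreme : ∀ {s} ts → Below s ts → eval Fs (extreme false εs s) ≤ eval Fs ts
  ≥-extreme ts b = ℤ.neg-cancel-≤ (eval-extreme false ls ts b)

  ≤-extreme : ∀ {s} ts → Below s ts → eval Fs ts ≤ eval Fs (extreme true εs s)
  ≤-extreme ts b = eval-extreme true ls ts b

-- Logarithms with respect to an increasing sequence

search : ∀ {Q : ℕ → Set} → (∀ m → Dec (Q m)) → ∀ n →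
         (∃[ m ] Q m × (∀ k → k ℕ.< m → ¬ Q k)) ⊎ (∀ k → k ℕ.< n → ¬ Q k)
search Q? zero    = inj₂ λ _ ()
search Q? (suc n) with search Q? n
... | inj₁ found = inj₁ found
... | inj₂ none with Q? n
...   | yes q = inj₁ (n , q , none)
...   | no ¬q = inj₂ λ k k<1+n q → rule-out k q (ℕ.m≤n⇒m<n∨m≡n (ℕ.s≤s⁻¹ k<1+n))
  where
  rule-out : ∀ k → _ → (k ℕ.< n) ⊎ (k ≡ n) → _
  rule-out k q (inj₁ k<n)  = none k k<n q
  rule-out k q (inj₂ refl) = ¬q q

module Log (θ : Seq) (0≤θ : ∀ t → 0ℤ ≤ θ t) (θ-step : ∀ t → θ t < θ (suc t)) where

  θ-unbounded : ∀ n → + n ≤ θ n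
  θ-unbounded zero    = 0≤θ 0
  θ-unbounded (suc n) = ℤ.≤-trans (ℤ.suc-mono (θ-unbounded n)) (ℤ.i<j⇒suc[i]≤j (θ-step n))

  private
    found : ∀ x → ∃[ m ] x ≤ θ m × (∀ k → k ℕ.< m → ¬ x ≤ θ k)
    found x with search (λ m → x ℤ.≤? θ m) (suc ∣ x ∣)
    ... | inj₁ m    = m
    ... | inj₂ none = ⊥-elim (none ∣ x ∣ ℕ.≤-refl (ℤ.≤-trans (≤+∣∣ x) (θ-unbounded ∣ x ∣)))

  log : ℤ → ℕ
  log x = proj₁ (found x)

  ≤-θ-log : ∀ x → x ≤ θ (log x)
  ≤-θ-log x = proj₁ (proj₂ (found x))

  θ-<-log : ∀ x {t} → t ℕ.< log x → θ t < x
  θ-<-log x t< = ℤ.≰⇒> (proj₂ (proj₂ (found x)) _ t<)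

  log-≤ : ∀ x {t} → x ≤ θ t → log x ℕ.≤ t
  log-≤ x x≤θt = ℕ.≮⇒≥ λ t< → ℤ.<⇒≱ (θ-<-log x t<) x≤θt

  log-mono : ∀ {x y} → x ≤ y → log x ℕ.≤ log y
  log-mono {x} {y} x≤y = log-≤ x (ℤ.≤-trans x≤y (≤-θ-log y))

  θ-mono : ∀ {s t} → s ℕ.≤ t → θ s ≤ θ t
  θ-mono {s} {t} s≤t with ℕ.m≤n⇒∃[o]m+o≡n s≤t
  ... | o , refl = subst (λ k → θ s ≤ θ k) (ℕ.+-comm o s) (climb o)
    where
    climb : ∀ o → θ s ≤ θ (o ℕ.+ s)
    climb zero    = ℤ.≤-refl
    climb (suc o) = ℤ.≤-trans (climb o) (ℤ.<⇒≤ (θ-step _))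

  -- Two comparisons determine a logarithm. In this form, that t is the leading entry becomes a
  -- statement about signs, which can be carried from one argument to another.
  log-unique : ∀ x {t} → x ≤ θ t → (t ≡ 0) ⊎ (θ (ℕ.pred t) < x) → log x ≡ t
  log-unique x x≤θt (inj₁ refl) = ℕ.n≤0⇒n≡0 (log-≤ x x≤θt)
  log-unique x {zero}  x≤θt (inj₂ _)    = ℕ.n≤0⇒n≡0 (log-≤ x x≤θt)
  log-unique x {suc t} x≤θt (inj₂ θt<x) = ℕ.≤-antisym (log-≤ x x≤θt)
    (ℕ.≰⇒> λ log≤t → ℤ.<⇒≱ θt<x (ℤ.≤-trans (≤-θ-log x) (θ-mono log≤t)))

  log-unique⁻¹ : ∀ x {t} → log x ≡ t → x ≤ θ t × ((t ≡ 0) ⊎ (θ (ℕ.pred t) < x))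
  log-unique⁻¹ x refl = ≤-θ-log x , lower (log x) refl
    where
    lower : ∀ t → log x ≡ t → (t ≡ 0) ⊎ (θ (ℕ.pred t) < x)
    lower zero    _  = inj₁ refl
    lower (suc t) eq = inj₂ (θ-<-log x (ℕ.≤-reflexive (sym eq)))

  log-nonpos : ∀ {x} → x ≤ 0ℤ → log x ≡ 0
  log-nonpos {x} x≤0 = ℕ.n≤0⇒n≡0 (log-≤ x (ℤ.≤-trans x≤0 (0≤θ 0)))

  private
    -- The bounds are y ≤ x + y ≤ 2 θ (log y) ≤ θ (K + log y).
    log-+-≤ : ∀ K → (∀ t → θ t + θ t ≤ θ (K ℕ.+ t)) → ∀ {x y} → 0ℤ ≤ x → log x ℕ.≤ log y →
              ∃[ i ] i ℕ.≤ K × log (x + y) ≡ i ℕ.+ log y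
    log-+-≤ K double {x} {y} 0≤x x≤y =
      _ , ℕ.m≤n+o⇒m∸n≤o _ (log y) (subst (log (x + y) ℕ.≤_) (ℕ.+-comm K (log y)) upper) ,
      sym (ℕ.m∸n+n≡m lower)
      where
      lower : log y ℕ.≤ log (x + y)
      lower = log-mono (subst (_≤ x + y) (ℤ.+-identityˡ y) (ℤ.+-monoˡ-≤ y 0≤x))
      upper : log (x + y) ℕ.≤ K ℕ.+ log y
      upper = log-≤ (x + y) (ℤ.≤-trans
        (ℤ.+-mono-≤ (ℤ.≤-trans (≤-θ-log x) (θ-mono x≤y)) (≤-θ-log y)) (double (log y)))

  log-+ : ∀ K → (∀ t → θ t + θ t ≤ θ (K ℕ.+ t)) → ∀ {x y} →
          (0ℤ ≤ x × 0ℤ ≤ y) ⊎ (x ≤ 0ℤ × y ≤ 0ℤ) →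
          ∃[ i ] i ℕ.≤ K × ((log (x + y) ≡ i ℕ.+ log x) ⊎ (log (x + y) ≡ i ℕ.+ log y))
  log-+ K double {x} {y} (inj₁ (0≤x , 0≤y)) with ℕ.≤-total (log x) (log y)
  ... | inj₁ x≤y = let i , i≤K , eq = log-+-≤ K double 0≤x x≤y in i , i≤K , inj₂ eq
  ... | inj₂ y≤x = let i , i≤K , eq = log-+-≤ K double 0≤y y≤x in
    i , i≤K , inj₁ (trans (cong log (ℤ.+-comm x y)) eq)
  log-+ K double (inj₂ (x≤0 , y≤0)) =
    0 , ℕ.z≤n , inj₁ (trans (log-nonpos (ℤ.+-mono-≤ x≤0 y≤0)) (sym (log-nonpos x≤0)))

module _ {n ε F} {εs : Vec Bool n} {Fs} (l : Layer ε εs F Fs) where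

  threshold-step : ∀ t → threshold ε εs F Fs t < threshold ε εs F Fs (suc t)
  threshold-step t = go ε l
    where
    go : ∀ ε → Layer ε εs F Fs → threshold ε εs F Fs t < threshold ε εs F Fs (suc t)
    go true  l = Layer.lex l _ _ ℕ.≤-refl (extreme-Below false εs _) (extreme-Below false εs _)
    go false l = ℤ.+-monoˡ-< (- 1ℤ)
      (Layer.lex l _ _ ℕ.≤-refl (extreme-Below false εs _) (extreme-Below false εs _))

  open Log (threshold ε εs F Fs) (Layer.nonneg l) threshold-step public

-- The tuple of largest value below v

leading : ∀ {n ε F} {εs : Vec Bool n} {Fs} → Layer ε εs F Fs → ℤ → ℕ
leading {ε = ε} l v = log l (sgn ε v)

module _ {n} (εs : Vec Bool n) (F : Seq) (Fs : Vec Seq n) where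

  -- All tuples with first entry t have value less than v, or t = 0 and there
  -- is only one such tuple.
  Saturated : ℤ → ℕ → Set
  Saturated v t = (t ≡ 0) ⊎ (F t + eval Fs (extreme true εs t) < v)

  saturated? : ∀ v t → Dec (Saturated v t)
  saturated? v t = (t ℕ.≟ 0) ⊎-dec (_ ℤ.<? v)

-- In the saturated case the best tail is the largest one bounded by the first entry. Otherwise v
-- cuts through the values of the possible tails; the remainder of v is then treated without any
-- bound on the entries, and the bound turns out to hold by itself.
P : ∀ {n} {εs : Vec Bool n} {Fs} → Layers εs Fs → ℤ → Vec ℕ n
P [] v = []
P {εs = ε ∷ εs} {F ∷ Fs} (l ∷ ls) v with saturated? εs F Fs v (leading l v)
... | yes _ = leading l v ∷ extreme true εs (leading l v)
... | no  _ = leading l v ∷ P ls (v - F (leading l v))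

module _ {n ε F} {εs : Vec Bool n} {Fs} (l : Layer ε εs F Fs) (ls : Layers εs Fs) (v : ℤ) where

  P-saturated : ∀ {t} → leading l v ≡ t → Saturated εs F Fs v t → P (l ∷ ls) v ≡ t ∷ extreme true εs t
  P-saturated refl s with saturated? εs F Fs v (leading l v)
  ... | yes _ = refl
  ... | no ¬s = ⊥-elim (¬s s)

  P-unsaturated : ∀ {t} → leading l v ≡ t → ¬ Saturated εs F Fs v t → P (l ∷ ls) v ≡ t ∷ P ls (v - F t)
  P-unsaturated refl ¬s with saturated? εs F Fs v (leading l v)
  ... | yes s = ⊥-elim (¬s s)
  ... | no _  = refl

module _ {n} (Fs : Vec Seq n) (v : ℤ) where

  SomeBelow : Set
  SomeBelow = ∃[ w ] Desc w × eval Fs w < v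

  record IsGreatestBelow (ts : Vec ℕ n) : Set where
    field
      desc    : Desc ts
      below   : SomeBelow → eval Fs ts < v
      largest : SomeBelow → ∀ w → Desc w → eval Fs w < v → eval Fs w ≤ eval Fs ts
      least   : ¬ SomeBelow → ∀ w → Desc w → eval Fs ts ≤ eval Fs w

open IsGreatestBelow

module _ {n ε F} {εs : Vec Bool n} {Fs} (l : Layer ε εs F Fs) (ls : Layers εs Fs) (v : ℤ) where

  private
    t : ℕ
    t = leading l v

    Dominated : ℕ → Vec ℕ n → Set
    Dominated s w = (s ≡ t) ⊎ (∀ us → Below t us → F s + eval Fs w < F t + eval Fs us)

  -- A first entry s ≠ t either makes the value reach v whatever the tail, against the hypothesis,
  -- or puts it below all tuples that start with t. Which of the two happens depends on ε and on the
  -- side of t on which s lies.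
  dominated : ∀ s w → Below s w → F s + eval Fs w < v → Dominated s w
  dominated s w b w<v with ℕ.<-cmp s t
  ... | tri≈ _ s≡t _ = inj₁ s≡t
  ... | tri< s<t _ _ = inj₂ λ us b′ → go ε l us b′ (θ-<-log l (sgn ε v) s<t)
    where
    go : ∀ ε (l : Layer ε εs F Fs) us → Below t us → threshold ε εs F Fs s < sgn ε v →
         F s + eval Fs w < F t + eval Fs us
    go true  l us b′ _ = Layer.lex l w us s<t b b′
    go false l us b′ h = ⊥-elim (ℤ.<⇒≱ w<v (ℤ.≤-trans v≤ (ℤ.+-monoʳ-≤ (F s) (≥-extreme ls w b))))
      where
      -- For ε false the threshold contains -1, so that the strict inequality `h` says exactly this.
      v≤ : v ≤ least-value εs F Fs s
      v≤ = ℤ.neg-cancel-≤ (≤-difference (identity (least-value εs F Fs s) v) (<⇒+1≤ h))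
        where
        identity : ∀ m v → - v - (- m - 1ℤ + 1ℤ) ≡ - v - - m
        identity = solve-∀
  ... | tri> _ _ t<s = inj₂ λ us b′ → go ε l us b′ (≤-θ-log l (sgn ε v))
    where
    go : ∀ ε (l : Layer ε εs F Fs) us → Below t us → sgn ε v ≤ threshold ε εs F Fs t →
         F s + eval Fs w < F t + eval Fs us
    go false l us b′ _ = ℤ.neg-cancel-< (Layer.lex l us w t<s b′ b)
    go true  l us b′ h = ⊥-elim (ℤ.<⇒≱ w<v (ℤ.≤-trans h (from-head (ℕ.m≤n⇒m<n∨m≡n t<s))))
      where
      from-head : (suc t ℕ.< s) ⊎ (suc t ≡ s) → least-value εs F Fs (suc t) ≤ F s + eval Fs w
      from-head (inj₁ lt)   = ℤ.<⇒≤ (Layer.lex l _ w lt (extreme-Below false εs _) b)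
      from-head (inj₂ refl) = ℤ.+-monoʳ-≤ (F s) (≥-extreme ls w b)

  -- For ε true the threshold at t - 1 is the least value at t and lies below v by minimality of the
  -- logarithm; for ε false use the threshold at t. In the remaining case, ε true and t = 0,
  -- possibly no tuple lies below v.
  least-value<v : (ε ≡ false) ⊎ (t ≢ 0) → least-value εs F Fs t < v
  least-value<v = go ε (≤-θ-log l (sgn ε v)) λ t≢0 →
    θ-<-log l (sgn ε v) (ℕ.≤-reflexive (ℕ.suc-pred t {{ℕ.≢-nonZero t≢0}}))
    where
    go : ∀ ε → sgn ε v ≤ threshold ε εs F Fs t → (t ≢ 0 → threshold ε εs F Fs (ℕ.pred t) < sgn ε v) →
         (ε ≡ false) ⊎ (t ≢ 0) → least-value εs F Fs t < v
    go false h _ _ = +1≤⇒< (≤-difference (identity (least-value εs F Fs t) v) h)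
      where
      identity : ∀ m v → (- m - 1ℤ) - (- v) ≡ v - (m + 1ℤ)
      identity = solve-∀
    go true _ h (inj₂ t≢0) = subst (λ k → least-value εs F Fs k < v)
      (ℕ.suc-pred t {{ℕ.≢-nonZero t≢0}}) (h t≢0)

  private
    top : Vec ℕ n
    top = extreme true εs t

    ≤-top : ∀ s w → Below s w → Dominated s w → F s + eval Fs w ≤ F t + eval Fs top
    ≤-top s w b (inj₁ refl) = ℤ.+-monoʳ-≤ (F s) (≤-extreme ls w b)
    ≤-top s w b (inj₂ lt)   = ℤ.<⇒≤ (lt top (extreme-Below true εs t))

  saturated-greatest : Saturated εs F Fs v t → least-value εs F Fs t < v →
                       IsGreatestBelow (F ∷ Fs) v (t ∷ top)
  saturated-greatest s low<v = record
    { desc    = extreme-Below true εs t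
    ; below   = λ _ → top<v s
    ; largest = λ { _ (s ∷ w) b w<v → ≤-top s w b (dominated s w b w<v) }
    ; least   = λ none → ⊥-elim (none (t ∷ top , extreme-Below true εs t , top<v s))
    }
    where
    top<v : Saturated εs F Fs v t → F t + eval Fs top < v
    top<v (inj₂ h)   = h
    top<v (inj₁ t≡0) = subst (λ us → F t + eval Fs us < v)
      (Below-0-unique _ _ (subst (λ s → Below s (extreme false εs t)) t≡0 (extreme-Below false εs t))
                          (subst (λ s → Below s top) t≡0 (extreme-Below true εs t))) low<v

  -- Only the zero tuple has first entry 0, and for ε true its value is the least of all. It is
  -- therefore the correct answer whether or not some tuple lies below v.
  zero-greatest : ε ≡ true → t ≡ 0 → IsGreatestBelow (F ∷ Fs) v (t ∷ top)
  zero-greatest ε≡true t≡0 = record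
    { desc    = extreme-Below true εs t
    ; below   = λ { (s ∷ w , b , w<v) → ℤ.≤-<-trans (minimal s w b) w<v }
    ; largest = λ { _ (s ∷ w) b w<v → ≤-top s w b (dominated s w b w<v) }
    ; least   = λ { _ (s ∷ w) b → minimal s w b }
    }
    where
    b₀ : Below 0 top
    b₀ = subst (λ s → Below s top) t≡0 (extreme-Below true εs t)
    equal : ∀ w → Below 0 w → F 0 + eval Fs w ≡ F t + eval Fs top
    equal w b = cong₂ (λ s us → F s + eval Fs us) (sym t≡0) (Below-0-unique w top b b₀)
    minimal : ∀ s w → Below s w → F t + eval Fs top ≤ F s + eval Fs w
    minimal zero    w b = ℤ.≤-reflexive (sym (equal w b))
    minimal (suc s) w b = ℤ.<⇒≤ (subst (λ ε → sgn ε (F t + eval Fs top) < sgn ε (F (suc s) + eval Fs w)) ε≡true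
      (Layer.lex l top w (subst (ℕ._< suc s) (sym t≡0) ℕ.z<s) (extreme-Below true εs t) b))

  unsaturated-greatest : ¬ Saturated εs F Fs v t → least-value εs F Fs t < v → ∀ us →
                         IsGreatestBelow Fs (v - F t) us → IsGreatestBelow (F ∷ Fs) v (t ∷ us)
  unsaturated-greatest ¬s low<v us g = record
    { desc    = between ls us (desc g) bottom≤us us<top
    ; below   = λ _ → t∷us<v
    ; largest = λ { _ (s ∷ w) b w<v → bound s w b w<v (dominated s w b w<v) }
    ; least   = λ none → ⊥-elim (none (_ , extreme-Below false εs t , low<v))
    }
    where
    split : ∀ {x} → F t + x < v → x < v - F t
    split {x} = <-difference (identity v (F t) x)
      where
      identity : ∀ v a x → v - (a + x) ≡ (v - a) - x
      identity = solve-∀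
    bottom : Vec ℕ n
    bottom = extreme false εs t
    somewhere : SomeBelow Fs (v - F t)
    somewhere = bottom , Below⇒Desc bottom (extreme-Below false εs t) , split low<v
    bottom≤us : eval Fs bottom ≤ eval Fs us
    bottom≤us = largest g somewhere bottom (proj₁ (proj₂ somewhere)) (proj₂ (proj₂ somewhere))
    us<top : eval Fs us < eval Fs top
    us<top = ℤ.<-≤-trans (below g somewhere)
      (≤-difference (identity (F t) (eval Fs top) v) (ℤ.≮⇒≥ (¬s ∘ inj₂)))
      where
      identity : ∀ a x v → (a + x) - v ≡ x - (v - a)
      identity = solve-∀
    t∷us<v : F t + eval Fs us < v
    t∷us<v = <-difference (identity v (F t) (eval Fs us)) (below g somewhere)
      where
      identity : ∀ v a x → (v - a) - x ≡ v - (a + x)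
      identity = solve-∀
    -- The recursion optimises over all decreasing tuples, not only those bounded by t. A value
    -- between the two extremes for t suffices: a first entry beyond t would, by `lex`, push the
    -- value out of this interval.
    between : ∀ {n} {εs : Vec Bool n} {Fs} → Layers εs Fs → ∀ us → Desc us →
              eval Fs (extreme false εs t) ≤ eval Fs us → eval Fs us < eval Fs (extreme true εs t) → Below t us
    between [] [] _ _ _ = tt
    between {εs = ε ∷ εs} {F ∷ Fs} (l ∷ ls) (p ∷ us) b lo hi = ℕ.≮⇒≥ (go ε l lo hi) , b
      where
      go : ∀ ε → Layer ε εs F Fs →
           eval (F ∷ Fs) (extreme false (ε ∷ εs) t) ≤ F p + eval Fs us →
           F p + eval Fs us < eval (F ∷ Fs) (extreme true (ε ∷ εs) t) → ¬ t ℕ.< p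
      go true  l lo hi t<p = ℤ.<-asym hi (Layer.lex l _ us t<p (extreme-Below true εs t) b)
      go false l lo hi t<p = ℤ.<⇒≱ (ℤ.neg-cancel-< (Layer.lex l _ us t<p (extreme-Below false εs t) b)) lo
    bound : ∀ s w → Below s w → F s + eval Fs w < v → Dominated s w → F s + eval Fs w ≤ F t + eval Fs us
    bound s w b w<v (inj₁ refl) = ℤ.+-monoʳ-≤ (F s) (largest g somewhere w (Below⇒Desc w b) (split w<v))
    bound s w b w<v (inj₂ lt)   = ℤ.<⇒≤ (lt us (between ls us (desc g) bottom≤us us<top))

P-greatest : ∀ {n} {εs : Vec Bool n} {Fs} (ls : Layers εs Fs) v → IsGreatestBelow Fs v (P ls v)
P-greatest [] v = record
  { desc    = tt
  ; below   = λ { ([] , _ , 0<v) → 0<v }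
  ; largest = λ { _ [] _ _ → ℤ.≤-refl }
  ; least   = λ { _ [] _ → ℤ.≤-refl }
  }
P-greatest {εs = ε ∷ εs} {F ∷ Fs} (l ∷ ls) v with saturated? εs F Fs v (leading l v)
... | no ¬s = unsaturated-greatest l ls v ¬s (least-value<v l ls v (inj₂ (¬s ∘ inj₁))) _
                (P-greatest ls (v - F (leading l v)))
... | yes s = cases ε refl (leading l v ℕ.≟ 0)
  where
  cases : ∀ ε′ → ε′ ≡ ε → Dec (leading l v ≡ 0) → IsGreatestBelow (F ∷ Fs) v (leading l v ∷ extreme true εs (leading l v))
  cases true  eq (yes t≡0) = zero-greatest l ls v (sym eq) t≡0
  cases false eq _         = saturated-greatest l ls v s (least-value<v l ls v (inj₁ (sym eq)))
  cases true  eq (no t≢0)  = saturated-greatest l ls v s (least-value<v l ls v (inj₂ t≢0))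

sgn-same : ∀ τ ε {x y} → 0ℤ ≤ sgn τ x → 0ℤ ≤ sgn τ y →
           (0ℤ ≤ sgn ε x × 0ℤ ≤ sgn ε y) ⊎ (sgn ε x ≤ 0ℤ × sgn ε y ≤ 0ℤ)
sgn-same true  true  0≤x 0≤y = inj₁ (0≤x , 0≤y)
sgn-same false false 0≤x 0≤y = inj₁ (0≤x , 0≤y)
sgn-same true  false 0≤x 0≤y = inj₂ (ℤ.neg-mono-≤ 0≤x , ℤ.neg-mono-≤ 0≤y)
sgn-same false true  0≤x 0≤y = inj₂ (ℤ.neg-cancel-≤ 0≤x , ℤ.neg-cancel-≤ 0≤y)

sgn-difference : ∀ τ {x y} → sgn τ x ≤ sgn τ y → 0ℤ ≤ sgn τ (y - x)
sgn-difference true  x≤y = ℤ.i≤j⇒0≤j-i x≤y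
sgn-difference false {x} {y} x≤y = ≤-difference (identity x y) x≤y
  where
  identity : ∀ x y → - y - - x ≡ - (y - x) - 0ℤ
  identity = solve-∀

-- The common sign τ of v and w need not be the sign ε of the layer; if they differ, both logarithms
-- are 0.
leading-+ : ∀ {n ε F} {εs : Vec Bool n} {Fs} (l : Layer ε εs F Fs) τ {v w} →
            0ℤ ≤ sgn τ v → 0ℤ ≤ sgn τ w →
            ∃[ i ] i ℕ.≤ Layer.K l × ((leading l (v + w) ≡ i ℕ.+ leading l v) ⊎ (leading l (v + w) ≡ i ℕ.+ leading l w))
leading-+ {ε = ε} l τ {v} {w} 0≤v 0≤w =
  subst (λ x → ∃[ i ] i ℕ.≤ Layer.K l × ((log l x ≡ i ℕ.+ leading l v) ⊎ (log l x ≡ i ℕ.+ leading l w)))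
    (sym (sgn-+ ε v w)) (log-+ l (Layer.K l) (Layer.double l) (sgn-same τ ε 0≤v 0≤w))

-- Growth of operators on a sparse set

∣∣≤⇒≤ : ∀ {i n} → ∣ i ∣ ℕ.≤ n → i ≤ + n
∣∣≤⇒≤ h = ℤ.≤-trans (≤+∣∣ _) (ℤ.+≤+ h)

∣∣≤⇒-≤ : ∀ {i n} → ∣ i ∣ ℕ.≤ n → - i ≤ + n
∣∣≤⇒-≤ {i} {n} h = ∣∣≤⇒≤ (subst (ℕ._≤ n) (sym (ℤ.∣-i∣≡∣i∣ i)) h)

negate : Operator → Operator
negate []       = []
negate (a ∷ as) = - a ∷ negate as

plus : Operator → Operator → Operator
plus []       bs       = bs
plus (a ∷ as) []       = a ∷ as
plus (a ∷ as) (b ∷ bs) = a + b ∷ plus as bs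

negates : ∀ {n} → Vec Operator n → Vec Operator n
negates []       = []
negates (O ∷ As) = negate O ∷ negates As

module Growing (r : ℕ → ℕ) (r-step : ∀ n → r n ℕ.< r (suc n)) where

  open OnPredicate r

  r-≤-+ : ∀ k n → r n ℕ.≤ r (k ℕ.+ n)
  r-≤-+ zero    n = ℕ.≤-refl
  r-≤-+ (suc k) n = ℕ.≤-trans (r-≤-+ k n) (ℕ.<⇒≤ (r-step _))

  r-mono : ∀ {m n} → m ℕ.≤ n → r m ℕ.≤ r n
  r-mono {m} m≤n with ℕ.m≤n⇒∃[o]m+o≡n m≤n
  ... | o , refl = subst (λ k → r m ℕ.≤ r k) (ℕ.+-comm o m) (r-≤-+ o m)

  r-mono-< : ∀ {m n} → m ℕ.< n → r m ℕ.< r n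
  r-mono-< m<n = ℕ.<-≤-trans (r-step _) (r-mono m<n)

  r-reflects : ∀ {m n} → r m ℕ.≤ r n → m ℕ.≤ n
  r-reflects le = ℕ.≮⇒≥ λ n<m → ℕ.<⇒≱ (r-mono-< n<m) le

  r-injective : ∀ {m n} → r m ≡ r n → m ≡ n
  r-injective eq = ℕ.≤-antisym (r-reflects (ℕ.≤-reflexive eq)) (r-reflects (ℕ.≤-reflexive (sym eq)))

  n≤r : ∀ n → n ℕ.≤ r n
  n≤r zero    = ℕ.z≤n
  n≤r (suc n) = ℕ.≤-<-trans (n≤r n) (r-step n)

  negate-⟨⟩ : ∀ O z → negate O ⟨ z ⟩ ≡ - (O ⟨ z ⟩)
  negate-⟨⟩ []       z = refl
  negate-⟨⟩ (a ∷ as) z = trans (cong (_+_ (- a * val z)) (negate-⟨⟩ as (suc z))) (identity a (val z) (as ⟨ suc z ⟩))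
    where
    identity : ∀ a v w → - a * v + - w ≡ - (a * v + w)
    identity = solve-∀

  plus-⟨⟩ : ∀ O O′ z → plus O O′ ⟨ z ⟩ ≡ O ⟨ z ⟩ + O′ ⟨ z ⟩
  plus-⟨⟩ []       bs       z = sym (ℤ.+-identityˡ _)
  plus-⟨⟩ (a ∷ as) []       z = sym (ℤ.+-identityʳ _)
  plus-⟨⟩ (a ∷ as) (b ∷ bs) z = trans (cong (_+_ ((a + b) * val z)) (plus-⟨⟩ as bs (suc z)))
    (identity a b (val z) (as ⟨ suc z ⟩) (bs ⟨ suc z ⟩))
    where
    identity : ∀ a b v x y → (a + b) * v + (x + y) ≡ (a * v + x) + (b * v + y)
    identity = solve-∀

  negates-· : ∀ {n} (As : Vec Operator n) z → negates As · z ≡ - (As · z)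
  negates-· []       []       = refl
  negates-· (O ∷ As) (z ∷ zs) = trans (cong₂ _+_ (negate-⟨⟩ O z) (negates-· As zs))
    (sym (ℤ.neg-distrib-+ (O ⟨ z ⟩) (As · zs)))

  -- b plays the part of the entry in front of the tuple.
  Gapped : ∀ {n} → ℕ → ℕ → Vec Elem n → Set
  Gapped Δ b []       = Δ ℕ.≤ b
  Gapped Δ b (z ∷ zs) = Δ ℕ.+ z ℕ.≤ b × Gapped Δ z zs

  Gapped⇒≥ : ∀ {n Δ b} (w : Vec Elem n) → Gapped Δ b w → Δ ℕ.≤ b
  Gapped⇒≥ []      h       = h
  Gapped⇒≥ (z ∷ w) (h , _) = ℕ.≤-trans (ℕ.m≤m+n _ z) h

  -- Up to the sign ε, the value of a gapped tuple with first entry h lies between r at h - lo and r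
  -- at h + hi. This bounded distortion is the source of the constant K of a layer; `lo≤Δ` makes the
  -- lower bound available for every gapped tuple.
  record Growth {n} (Δ : ℕ) (ε : Bool) (O : Operator) (As : Vec Operator n) : Set where
    field
      lex   : ∀ {h h′} (w w′ : Vec Elem n) → h ℕ.< h′ → Gapped Δ h w → Gapped Δ h′ w′ →
              sgn ε (O ⟨ h ⟩ + As · w) < sgn ε (O ⟨ h′ ⟩ + As · w′)
      lo hi : ℕ
      lo≤Δ  : lo ℕ.≤ Δ
      lower : ∀ {h} y (w : Vec Elem n) → lo ℕ.+ y ℕ.≤ h → Gapped Δ h w →
              val y < sgn ε (O ⟨ h ⟩ + As · w)
      upper : ∀ {h} (w : Vec Elem n) → Gapped Δ h w →
              sgn ε (O ⟨ h ⟩ + As · w) ≤ val (hi ℕ.+ h)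

  module OnSparse (sparse : Sparse) where

    open Sparse sparse

    abstract
      doubling : ∃[ D ] ∀ z → r z ℕ.+ r z ℕ.≤ r (D ℕ.+ z)
      -- S2 for the operator σ - 1 gives r (Δ + 1 + z) > r (Δ + z) + r z ≥ 2 r z.
      doubling with S2 (-1ℤ ∷ 1ℤ ∷ []) (0 , λ z _ → difference-pos z)
        where
        identity : ∀ a b → b - a ≡ (-1ℤ * a + (1ℤ * b + 0ℤ)) - 0ℤ
        identity = solve-∀
        difference-pos : ∀ z → 0ℤ < -1ℤ * val z + (1ℤ * val (suc z) + 0ℤ)
        difference-pos z = <-difference (identity (val z) (val (suc z))) (ℤ.+<+ (r-step z))
      ... | Δ , h = suc Δ , λ z → ℕ.≤-trans (ℕ.+-monoʳ-≤ (r z) (r-≤-+ Δ z)) (ℕ.<⇒≤ (ℤ.drop‿+<+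
        (<-difference (identity (val z) (val (Δ ℕ.+ z)) (val (suc Δ ℕ.+ z))) (h z))))
        where
        identity : ∀ a b c → (-1ℤ * b + (1ℤ * c + 0ℤ)) - a ≡ c - (a + b)
        identity = solve-∀

    D : ℕ
    D = proj₁ doubling

    r-double : ∀ z → r z ℕ.+ r z ℕ.≤ r (D ℕ.+ z)
    r-double = proj₂ doubling

    r-sum : ∀ x y h → r (x ℕ.+ h) ℕ.+ r (y ℕ.+ h) ℕ.≤ r (D ℕ.+ (x ℕ.+ y) ℕ.+ h)
    r-sum x y h = ℕ.≤-trans (ℕ.+-mono-≤ (r-mono (ℕ.+-monoˡ-≤ h (ℕ.m≤m+n x y))) (r-mono (ℕ.+-monoˡ-≤ h (ℕ.m≤n+m y x))))
      (subst (λ k → r (x ℕ.+ y ℕ.+ h) ℕ.+ r (x ℕ.+ y ℕ.+ h) ℕ.≤ r k) (sym (ℕ.+-assoc D (x ℕ.+ y) h)) (r-double _))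

    scalar-bound : ∀ a → ∃[ e ] ∀ h → a ℕ.* r h ℕ.≤ r (e ℕ.+ h)
    scalar-bound zero    = 0 , λ h → ℕ.z≤n
    scalar-bound (suc a) = let e , b = scalar-bound a in
      D ℕ.+ e , λ h → ℕ.≤-trans (ℕ.+-monoʳ-≤ (r h) (b h)) (r-sum 0 e h)

    operator-bound : ∀ O → ∃[ e ] ∀ {h z} → z ℕ.≤ h → ∣ O ⟨ z ⟩ ∣ ℕ.≤ r (e ℕ.+ h)
    operator-bound []       = 0 , λ _ → ℕ.z≤n
    operator-bound (a ∷ as) = let e , b = scalar-bound ∣ a ∣ ; e′ , b′ = operator-bound as in
      D ℕ.+ (e ℕ.+ suc e′) , λ {h} {z} z≤h → ℕ.≤-trans (ℤ.∣i+j∣≤∣i∣+∣j∣ (a * val z) (as ⟨ suc z ⟩))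
        (ℕ.≤-trans (ℕ.+-mono-≤
          (ℕ.≤-trans (ℕ.≤-reflexive (ℤ.abs-* a (val z))) (ℕ.≤-trans (ℕ.*-monoʳ-≤ ∣ a ∣ (r-mono z≤h)) (b h)))
          (subst (λ k → ∣ as ⟨ suc z ⟩ ∣ ℕ.≤ r k) (ℕ.+-suc e′ h) (b′ (ℕ.s≤s z≤h))))
        (r-sum e (suc e′) h))

    -- All entries lie at least Δ below b, hence are at most q. The constant e does not depend on Δ,
    -- so Δ can be chosen after it.
    tuple-bound : ∀ {n} (As : Vec Operator n) →
      ∃[ e ] ∀ {Δ b q} w → Gapped Δ b w → b ℕ.≤ Δ ℕ.+ q → ∣ As · w ∣ ℕ.≤ r (e ℕ.+ q)
    tuple-bound []       = 0 , λ { [] _ _ → ℕ.z≤n }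
    tuple-bound (O ∷ As) = let e , b = operator-bound O ; e′ , b′ = tuple-bound As in
      D ℕ.+ (e ℕ.+ e′) , λ { {Δ} {_} {q} (z ∷ w) (Δ+z≤b , g) b≤Δ+q →
        let z≤q = ℕ.+-cancelˡ-≤ Δ z q (ℕ.≤-trans Δ+z≤b b≤Δ+q) in
        ℕ.≤-trans (ℤ.∣i+j∣≤∣i∣+∣j∣ (O ⟨ z ⟩) (As · w))
          (ℕ.≤-trans (ℕ.+-mono-≤ (b z≤q) (b′ w g (ℕ.≤-trans z≤q (ℕ.m≤n+m q Δ)))) (r-sum e e′ q)) }

    module _ (O : Operator) (O>0 : O >R0) where

      private
        s₂ : ℕ
        s₂ = proj₁ (S2 O O>0)

        O-large : ∀ z → val z < O ⟨ s₂ ℕ.+ z ⟩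
        O-large = proj₂ (S2 O O>0)

        -- A nonincreasing operator is bounded above, whereas S2 makes O exceed every element of R.
        not-decreasing : ∀ k → ¬ (∀ z → k ℕ.≤ z → O ⟨ suc z ⟩ ≤ O ⟨ z ⟩)
        not-decreasing k dec = ℤ.<⇒≱ (O-large z) (ℤ.≤-trans (bounded (s₂ ℕ.+ ∣ O ⟨ k ⟩ ∣))
            (ℤ.≤-trans (≤+∣∣ (O ⟨ k ⟩)) (ℤ.+≤+ (ℕ.≤-trans (ℕ.m≤m+n _ k) (n≤r z)))))
          where
          z : ℕ
          z = ∣ O ⟨ k ⟩ ∣ ℕ.+ k
          descend : ∀ j → O ⟨ j ℕ.+ k ⟩ ≤ O ⟨ k ⟩
          descend zero    = ℤ.≤-refl
          descend (suc j) = ℤ.≤-trans (dec (j ℕ.+ k) (ℕ.m≤n+m k j)) (descend j)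
          bounded : ∀ j → O ⟨ s₂ ℕ.+ z ⟩ ≤ O ⟨ k ⟩
          bounded _ = subst (λ m → O ⟨ m ⟩ ≤ O ⟨ k ⟩) (ℕ.+-assoc s₂ _ k) (descend (s₂ ℕ.+ ∣ O ⟨ k ⟩ ∣))

        -- The difference operator z ↦ O(σz) - Oz. S1 leaves three cases, two of which would make O
        -- eventually nonincreasing; S2 then bounds the jumps of O from below by elements of R.
        Δ-operator : Operator
        Δ-operator = plus (0ℤ ∷ O) (negate O)

        Δ-operator-⟨⟩ : ∀ z → Δ-operator ⟨ z ⟩ ≡ O ⟨ suc z ⟩ - O ⟨ z ⟩
        Δ-operator-⟨⟩ z = trans (plus-⟨⟩ (0ℤ ∷ O) (negate O) z)
          (cong₂ _+_ (trans (cong (_+ O ⟨ suc z ⟩) (ℤ.*-zeroˡ (val z))) (ℤ.+-identityˡ (O ⟨ suc z ⟩))) (negate-⟨⟩ O z))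

        nonincreasing : ∀ z → Δ-operator ⟨ z ⟩ ≤ 0ℤ → O ⟨ suc z ⟩ ≤ O ⟨ z ⟩
        nonincreasing z h = ℤ.i-j≤0⇒i≤j (subst (_≤ 0ℤ) (Δ-operator-⟨⟩ z) h)

        abstract
          Δ-operator>0 : Δ-operator >R0
          Δ-operator>0 with S1 Δ-operator
          ... | inj₁ =0              = ⊥-elim (not-decreasing 0 λ z _ → nonincreasing z (ℤ.≤-reflexive (=0 z)))
          ... | inj₂ (inj₁ >0)       = >0
          ... | inj₂ (inj₂ (k , <0)) = ⊥-elim (not-decreasing k λ z k≤z → nonincreasing z (ℤ.<⇒≤ (<0 z k≤z)))

        s₁ : ℕ
        s₁ = proj₁ (S2 Δ-operator Δ-operator>0)

        jump : ∀ z → val z < O ⟨ suc s₁ ℕ.+ z ⟩ - O ⟨ s₁ ℕ.+ z ⟩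
        jump z = subst (val z <_) (Δ-operator-⟨⟩ (s₁ ℕ.+ z)) (proj₂ (S2 Δ-operator Δ-operator>0) z)

        O-mono : ∀ {z z′} → s₁ ℕ.≤ z → z ℕ.≤ z′ → O ⟨ z ⟩ ≤ O ⟨ z′ ⟩
        O-mono {z} s₁≤z z≤z′ with ℕ.m≤n⇒∃[o]m+o≡n s₁≤z | ℕ.m≤n⇒∃[o]m+o≡n z≤z′
        ... | p , refl | o , refl = subst (λ k → O ⟨ z ⟩ ≤ O ⟨ k ⟩) (ℕ.+-comm o z) (climb o)
          where
          step : ∀ x → O ⟨ s₁ ℕ.+ x ⟩ ≤ O ⟨ suc (s₁ ℕ.+ x) ⟩
          step x = ℤ.0≤i-j⇒j≤i {O ⟨ suc (s₁ ℕ.+ x) ⟩} (ℤ.≤-trans (ℤ.+≤+ ℕ.z≤n) (ℤ.<⇒≤ (jump x)))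
          climb : ∀ o → O ⟨ z ⟩ ≤ O ⟨ o ℕ.+ z ⟩
          climb zero    = ℤ.≤-refl
          climb (suc o) = ℤ.≤-trans (climb o) (subst (λ k → O ⟨ k ⟩ ≤ O ⟨ suc k ⟩) (swap s₁ o p) (step (o ℕ.+ p)))
            where
            swap : ∀ a b c → a ℕ.+ (b ℕ.+ c) ≡ b ℕ.+ (a ℕ.+ c)
            swap = ℕ-solver.solve-∀

      growth⁺ : ∀ {n} (As : Vec Operator n) → ∃[ Δ₀ ] ∀ Δ → Δ₀ ℕ.≤ Δ → Growth Δ true O As
      growth⁺ As = Δ₀ , λ Δ Δ₀≤Δ → record
        { lex   = lex Δ Δ₀≤Δ
        ; lo    = s
        ; hi    = D ℕ.+ (eO ℕ.+ e)
        ; lo≤Δ  = ℕ.≤-trans (ℕ.m≤n+m s (suc s₁ ℕ.+ m)) Δ₀≤Δ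
        ; lower = lower Δ (ℕ.≤-trans (ℕ.m≤n+m s (suc s₁ ℕ.+ m)) Δ₀≤Δ)
        ; upper = λ {h} w g → ℤ.≤-trans (≤+∣∣ _) (ℤ.+≤+ (ℕ.≤-trans (ℤ.∣i+j∣≤∣i∣+∣j∣ (O ⟨ h ⟩) (As · w))
            (ℕ.≤-trans (ℕ.+-mono-≤ (proj₂ (operator-bound O) ℕ.≤-refl) (As-bound w g (ℕ.m≤n+m h Δ))) (r-sum eO e h))))
        }
        where
        eO e m s Δ₀ : ℕ
        eO = proj₁ (operator-bound O)
        e  = proj₁ (tuple-bound As)
        m  = D ℕ.+ (e ℕ.+ e)
        s  = s₂ ℕ.+ (D ℕ.+ e)
        Δ₀ = suc s₁ ℕ.+ m ℕ.+ s
        As-bound : ∀ {Δ b q} w → Gapped Δ b w → b ℕ.≤ Δ ℕ.+ q → ∣ As · w ∣ ℕ.≤ r (e ℕ.+ q)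
        As-bound = proj₂ (tuple-bound As)

        -- With q = h - s, S2 gives O ⟨ h ⟩ > r (D + e + q) ≥ 2 r (e + q). The tail is at most r (e
        -- + q) in absolute value, so more than r (e + q) ≥ r y remains.
        lower : ∀ Δ → s ℕ.≤ Δ → ∀ {h} y w → s ℕ.+ y ℕ.≤ h → Gapped Δ h w → val y < O ⟨ h ⟩ + As · w
        lower Δ s≤Δ y w s+y≤h g with ℕ.m≤n⇒∃[o]m+o≡n s+y≤h
        ... | x , refl = ℤ.≤-<-trans (ℤ.+≤+ (ℕ.≤-trans (r-≤-+ x y) (ℕ.≤-trans (ℕ.≤-reflexive (cong r (ℕ.+-comm x y))) (r-≤-+ e q))))
            (<-difference (identity (O ⟨ _ ⟩) (val (e ℕ.+ q)) (As · w))
              (ℤ.≤-<-trans (ℤ.+-mono-≤ (ℤ.≤-refl {val (e ℕ.+ q)}) neg-As≤)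
                (ℤ.≤-<-trans (ℤ.+≤+ (r-double (e ℕ.+ q)))
                  (subst (λ k → val (D ℕ.+ (e ℕ.+ q)) < O ⟨ k ⟩) (rearrange s₂ D e y x) (O-large (D ℕ.+ (e ℕ.+ q)))))))
          where
          q : ℕ
          q = y ℕ.+ x
          rearrange : ∀ a b c y x → a ℕ.+ (b ℕ.+ (c ℕ.+ (y ℕ.+ x))) ≡ a ℕ.+ (b ℕ.+ c) ℕ.+ y ℕ.+ x
          rearrange = ℕ-solver.solve-∀
          identity : ∀ o v a → o - (v + - a) ≡ (o + a) - v
          identity = solve-∀
          neg-As≤ : - (As · w) ≤ val (e ℕ.+ q)
          neg-As≤ = ∣∣≤⇒-≤ (As-bound w g (subst (ℕ._≤ Δ ℕ.+ q) (sym (ℕ.+-assoc s y x)) (ℕ.+-monoˡ-≤ q s≤Δ)))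

        -- Put q = h′ - Δ. The two tails together contribute at most 2 r (e + q) ≤ r (m + q). The
        -- choice of `Δ₀` places h′ at least suc s₁ + m + q, so already the last jump of O before h′
        -- exceeds this amount, and O is monotone from s₁ on.
        lex : ∀ Δ → Δ₀ ℕ.≤ Δ → ∀ {h h′} w w′ → h ℕ.< h′ → Gapped Δ h w → Gapped Δ h′ w′ →
              O ⟨ h ⟩ + As · w < O ⟨ h′ ⟩ + As · w′
        lex Δ Δ₀≤Δ {h} {h′} w w′ h<h′ g g′ with ℕ.m≤n⇒∃[o]m+o≡n Δ₀≤Δ | ℕ.m≤n⇒∃[o]m+o≡n (Gapped⇒≥ w′ g′)
        ... | x , refl | q , refl = <-difference (identity (O ⟨ h′ ⟩) (O ⟨ h ⟩) (As · w) (As · w′))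
            (ℤ.≤-<-trans (ℤ.+-mono-≤ (∣∣≤⇒≤ {As · w} (As-bound w g (ℕ.<⇒≤ h<h′))) (∣∣≤⇒-≤ {As · w′} (As-bound w′ g′ ℕ.≤-refl)))
            (ℤ.≤-<-trans (ℤ.+≤+ (ℕ.≤-trans (r-sum e e q) (r-mono (ℕ.+-monoˡ-≤ q m≤))))
            (ℤ.<-≤-trans (jump y) (ℤ.+-mono-≤ (ℤ.≤-reflexive (cong (O ⟨_⟩) (sym h′≡)))
                                              (ℤ.neg-mono-≤ (O-mono s₁≤h h≤))))))
          where
          y : ℕ
          y = m ℕ.+ s ℕ.+ x ℕ.+ q
          identity : ∀ a b c d → (a - b) - (c - d) ≡ (a + d) - (b + c)
          identity = solve-∀
          m≤ : m ℕ.≤ m ℕ.+ s ℕ.+ x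
          m≤ = ℕ.≤-trans (ℕ.m≤m+n m s) (ℕ.m≤m+n _ x)
          h′≡ : h′ ≡ suc s₁ ℕ.+ y
          h′≡ = rearrange s₁ m s x q
            where
            rearrange : ∀ a b c x y → suc a ℕ.+ b ℕ.+ c ℕ.+ x ℕ.+ y ≡ suc a ℕ.+ (b ℕ.+ c ℕ.+ x ℕ.+ y)
            rearrange = ℕ-solver.solve-∀
          h≤ : h ℕ.≤ s₁ ℕ.+ y
          h≤ = ℕ.s≤s⁻¹ (subst (h ℕ.<_) h′≡ h<h′)
          s₁≤h : s₁ ℕ.≤ h
          s₁≤h = ℕ.≤-trans (ℕ.≤-trans (ℕ.≤-trans (ℕ.n≤1+n s₁) (ℕ.m≤m+n (suc s₁) (m ℕ.+ s)))
            (ℕ.≤-reflexive (sym (ℕ.+-assoc (suc s₁) m s)))) (ℕ.≤-trans Δ₀≤Δ (Gapped⇒≥ w g))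

    negative-growth : ∀ {n Δ O} {As : Vec Operator n} → Growth Δ true (negate O) (negates As) → Growth Δ false O As
    negative-growth {O = O} {As} G = record
      { lex   = λ {h} {h′} w w′ h<h′ g g′ → subst₂ _<_ (value h w) (value h′ w′) (Growth.lex G w w′ h<h′ g g′)
      ; lo    = Growth.lo G
      ; hi    = Growth.hi G
      ; lo≤Δ  = Growth.lo≤Δ G
      ; lower = λ {h} y w le g → subst (val y <_) (value h w) (Growth.lower G y w le g)
      ; upper = λ {h} w g → subst (_≤ val (Growth.hi G ℕ.+ h)) (value h w) (Growth.upper G w g)
      }
      where
      value : ∀ h w → negate O ⟨ h ⟩ + negates As · w ≡ - (O ⟨ h ⟩ + As · w)
      value h w = trans (cong₂ _+_ (negate-⟨⟩ O h) (negates-· As w)) (sym (ℤ.neg-distrib-+ (O ⟨ h ⟩) (As · w)))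

    growth : ∀ {n} O (As : Vec Operator n) → ¬ O =R0 →
             ∃[ ε ] ∃[ Δ₀ ] ∀ Δ → Δ₀ ℕ.≤ Δ → Growth Δ ε O As
    growth O As O≠0 with S1 O
    ... | inj₁ =0              = ⊥-elim (O≠0 =0)
    ... | inj₂ (inj₁ >0)       = true , growth⁺ O >0 As
    ... | inj₂ (inj₂ (k , <0)) =
      let Δ₀ , G = growth⁺ (negate O) (k , λ z k≤z → subst (0ℤ <_) (sym (negate-⟨⟩ O z)) (ℤ.neg-mono-< (<0 z k≤z))) (negates As)
      in false , Δ₀ , λ Δ Δ₀≤Δ → negative-growth (G Δ Δ₀≤Δ)

  data Growths (Δ : ℕ) : ∀ {n} → Vec Bool n → Vec Operator n → Set where
    []  : Growths Δ [] []
    _∷_ : ∀ {n ε O} {εs : Vec Bool n} {As} → Growth Δ ε O As → Growths Δ εs As → Growths Δ (ε ∷ εs) (O ∷ As)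

  growths : Sparse → ∀ {n} (As : Vec Operator n) → (∀ i → ¬ lookup As i =R0) →
            ∃[ εs ] ∃[ Δ₀ ] ∀ Δ → Δ₀ ℕ.≤ Δ → Growths Δ εs As
  growths sparse []       _   = [] , 0 , λ _ _ → []
  growths sparse (O ∷ As) A≠0 =
    let ε  , Δ₀ , G  = OnSparse.growth sparse O As (A≠0 zero)
        εs , Δ₁ , Gs = growths sparse As (A≠0 ∘ suc)
    in ε ∷ εs , Δ₀ ℕ.⊔ Δ₁ , λ Δ ≤Δ → G Δ (ℕ.m⊔n≤o⇒m≤o Δ₀ Δ₁ ≤Δ) ∷ Gs Δ (ℕ.m⊔n≤o⇒n≤o Δ₀ Δ₁ ≤Δ)

  -- Spaced tuples as weakly decreasing tuples

  Chain : ∀ {n} → ℕ → Vec Elem n → Set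
  Chain Δ []      = ⊤
  Chain Δ (z ∷ w) = Gapped Δ z w

  Gapped⇒Chain : ∀ {n Δ b} (w : Vec Elem n) → Gapped Δ b w → Chain Δ w
  Gapped⇒Chain []      _       = tt
  Gapped⇒Chain (z ∷ w) (_ , g) = g

  ·-injective : ∀ {n Δ} {εs : Vec Bool n} {As} → Growths Δ εs As → ∀ z z′ → Chain Δ z → Chain Δ z′ →
                As · z ≡ As · z′ → z ≡ z′
  ·-injective [] [] [] _ _ _ = refl
  ·-injective {εs = ε ∷ _} {O ∷ As} (G ∷ Gs) (h ∷ w) (h′ ∷ w′) g g′ eq with ℕ.<-cmp h h′
  ... | tri< h<h′ _ _ = ⊥-elim (ℤ.<-irrefl (cong (sgn ε) eq) (Growth.lex G w w′ h<h′ g g′))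
  ... | tri> _ _ h′<h = ⊥-elim (ℤ.<-irrefl (cong (sgn ε) (sym eq)) (Growth.lex G w′ w h′<h g′ g))
  ... | tri≈ _ refl _ = cong (h ∷_) (·-injective Gs w w′ (Gapped⇒Chain w g) (Gapped⇒Chain w′ g′)
    (subst₂ _≡_ (cancelˡ (O ⟨ h ⟩) (As · w)) (cancelˡ (O ⟨ h ⟩) (As · w′)) (cong (_+_ (- (O ⟨ h ⟩))) eq)))
    where
    cancelˡ : ∀ a b → - a + (a + b) ≡ b
    cancelˡ = solve-∀

  module _ {d N Δ : ℕ} where

    Spaced-tail : ∀ {n z} {w : Vec Elem n} → Spaced d N Δ (z ∷ w) → Spaced d N Δ w
    Spaced-tail S = record { inSub = Spaced.inSub S ∘ suc ; spaced = Spaced.spaced S ∘ suc }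

    Spaced-head : ∀ {n z} {w : Vec Elem n} → Spaced d N Δ (z ∷ w) → (∃[ s ] z ≡ N ℕ.+ d ℕ.* s) ×
                  Δ ℕ.+ lookup (w ∷ʳ N) zero ℕ.≤ z
    Spaced-head S = (let s , eq = Spaced.inSub S zero in s , r-injective eq) ,
                    r-reflects (ℤ.drop‿+≤+ (Spaced.spaced S zero))

    Spaced-cons : ∀ {n z} {w : Vec Elem n} → (∃[ s ] z ≡ N ℕ.+ d ℕ.* s) → Δ ℕ.+ lookup (w ∷ʳ N) zero ℕ.≤ z →
                  Spaced d N Δ w → Spaced d N Δ (z ∷ w)
    Spaced-cons (s , eq) le S = record
      { inSub  = λ { zero → s , cong r eq ; (suc i) → Spaced.inSub S i }
      ; spaced = λ { zero → ℤ.+≤+ (r-mono le) ; (suc i) → Spaced.spaced S i }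
      }

    Spaced-[] : Spaced d N Δ []
    Spaced-[] = record { inSub = λ () ; spaced = λ () }

    Spaced⇒Gapped : ∀ {n z} (w : Vec Elem n) → Spaced d N Δ (z ∷ w) → Gapped Δ z w
    Spaced⇒Gapped []      S = ℕ.≤-trans (ℕ.m≤m+n Δ N) (proj₂ (Spaced-head S))
    Spaced⇒Gapped (y ∷ w) S = proj₂ (Spaced-head S) , Spaced⇒Gapped w (Spaced-tail S)

    Spaced⇒Chain : ∀ {n} (z : Vec Elem n) → Spaced d N Δ z → Chain Δ z
    Spaced⇒Chain []      _ = tt
    Spaced⇒Chain (z ∷ w) S = Spaced⇒Gapped w S

  -- For d ∣ Δ the entries of a spaced tuple are
  -- z_i = (n + 1 - i) Δ + N + d t_i with t weakly decreasing.
  module Grid (d N δ : ℕ) .{{_ : NonZero d}} where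

    Δ : ℕ
    Δ = δ ℕ.* d

    position : ℕ → ℕ → Elem
    position k t = k ℕ.* Δ ℕ.+ (N ℕ.+ d ℕ.* t)

    embed : ∀ {n} → Vec ℕ n → Vec Elem n
    embed []               = []
    embed {suc n} (t ∷ ts) = position (suc n) t ∷ embed ts

    sequences : ∀ {n} → Vec Operator n → Vec Seq n
    sequences []               = []
    sequences {suc n} (O ∷ As) = (λ t → O ⟨ position (suc n) t ⟩) ∷ sequences As

    eval-sequences : ∀ {n} (As : Vec Operator n) ts → eval (sequences As) ts ≡ As · embed ts
    eval-sequences []       []       = refl
    eval-sequences {suc n} (O ∷ As) (t ∷ ts) = cong (_+_ (O ⟨ position (suc n) t ⟩)) (eval-sequences As ts)

    position-suc : ∀ n t → position (suc n) t ≡ Δ ℕ.+ position n t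
    position-suc n t = ℕ.+-assoc Δ (n ℕ.* Δ) _

    position-mono : ∀ n {s t} → s ℕ.≤ t → position n s ℕ.≤ position n t
    position-mono n s≤t = ℕ.+-monoʳ-≤ (n ℕ.* Δ) (ℕ.+-monoʳ-≤ N (ℕ.*-monoʳ-≤ d s≤t))

    position-mono-< : ∀ n {s t} → s ℕ.< t → position n s ℕ.< position n t
    position-mono-< n s<t = ℕ.+-monoʳ-< (n ℕ.* Δ) (ℕ.+-monoʳ-< N (ℕ.*-monoʳ-< d s<t))

    gap : ∀ n {s t} → s ℕ.≤ t → Δ ℕ.+ position n s ℕ.≤ position (suc n) t
    gap n {s} {t} s≤t = subst (ℕ._≤ position (suc n) t) (position-suc n s) (position-mono (suc n) s≤t)

    Below⇒Gapped : ∀ {n t} (ts : Vec ℕ n) → Below t ts → Gapped Δ (position (suc n) t) (embed ts)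
    Below⇒Gapped {t = t} []   _        = ℕ.≤-trans (ℕ.m≤m+n Δ 0) (ℕ.m≤m+n (Δ ℕ.+ 0) _)
    Below⇒Gapped {suc n} (s ∷ ts) (s≤t , b) = gap (suc n) s≤t , Below⇒Gapped ts b

    position-inSub : ∀ n t → ∃[ s ] position n t ≡ N ℕ.+ d ℕ.* s
    position-inSub n t = n ℕ.* δ ℕ.+ t , identity n δ d N t
      where
      identity : ∀ n δ d N t → n ℕ.* (δ ℕ.* d) ℕ.+ (N ℕ.+ d ℕ.* t) ≡ N ℕ.+ d ℕ.* (n ℕ.* δ ℕ.+ t)
      identity = ℕ-solver.solve-∀

    -- Since Δ = δ d, the shift by n Δ is a shift by n δ along the progression, and subtracting n δ
    -- recovers t′.
    position-cofinal : ∀ n t s → position n t ℕ.≤ N ℕ.+ d ℕ.* s →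
                       ∃[ t′ ] t ℕ.≤ t′ × N ℕ.+ d ℕ.* s ≡ position n t′
    position-cofinal n t s le = s ℕ.∸ n ℕ.* δ , ℕ.m+n≤o⇒m≤o∸n t t+nδ≤s , eq
      where
      nδ+t≤s : n ℕ.* δ ℕ.+ t ℕ.≤ s
      nδ+t≤s = ℕ.*-cancelˡ-≤ d (ℕ.+-cancelˡ-≤ N _ _ (subst (ℕ._≤ N ℕ.+ d ℕ.* s) (proj₂ (position-inSub n t)) le))
      t+nδ≤s : t ℕ.+ n ℕ.* δ ℕ.≤ s
      t+nδ≤s = subst (ℕ._≤ s) (ℕ.+-comm (n ℕ.* δ) t) nδ+t≤s
      eq : N ℕ.+ d ℕ.* s ≡ position n (s ℕ.∸ n ℕ.* δ)
      eq = trans (cong (λ k → N ℕ.+ d ℕ.* k) (sym (ℕ.m+[n∸m]≡n (ℕ.≤-trans (ℕ.m≤m+n _ t) nδ+t≤s))))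
                 (sym (proj₂ (position-inSub n (s ℕ.∸ n ℕ.* δ))))

    embed-Spaced : ∀ {n} (ts : Vec ℕ n) → Desc ts → Spaced d N Δ (embed ts)
    embed-Spaced []           _         = Spaced-[]
    embed-Spaced (t ∷ [])     _         = Spaced-cons (position-inSub 1 t)
      (ℕ.+-mono-≤ (ℕ.m≤m+n Δ 0) (ℕ.m≤m+n N _)) Spaced-[]
    embed-Spaced {suc (suc n)} (t ∷ s ∷ ts) (s≤t , b) = Spaced-cons (position-inSub (suc (suc n)) t)
      (gap (suc n) s≤t) (embed-Spaced (s ∷ ts) b)

    Spaced-embed : ∀ {n} (z : Vec Elem n) → Spaced d N Δ z → ∃[ ts ] Desc ts × z ≡ embed ts
    Spaced-embed []       _ = [] , tt , refl
    Spaced-embed (z ∷ []) S with Spaced-head S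
    ... | (s , refl) , le with position-cofinal 1 0 s (subst (ℕ._≤ N ℕ.+ d ℕ.* s) (identity δ d N) le)
      where
      identity : ∀ δ d N → δ ℕ.* d ℕ.+ N ≡ 1 ℕ.* (δ ℕ.* d) ℕ.+ (N ℕ.+ d ℕ.* 0)
      identity = ℕ-solver.solve-∀
    ...   | t , _ , eq = t ∷ [] , tt , cong (_∷ []) eq
    Spaced-embed {suc (suc n)} (z ∷ w@(_ ∷ _)) S with Spaced-head S | Spaced-embed w (Spaced-tail S)
    ... | (s , refl) , le | u ∷ ts , b , refl
      with position-cofinal (suc (suc n)) u s (subst (ℕ._≤ N ℕ.+ d ℕ.* s) (sym (position-suc (suc n) u)) le)
    ...   | t , u≤t , eq = t ∷ u ∷ ts , (u≤t , b) , cong (_∷ embed (u ∷ ts)) eq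

    IsP-embed : ∀ {n} {As : Vec Operator n} {v ts} → IsGreatestBelow (sequences As) v ts →
                IsP As d N Δ v (embed ts)
    IsP-embed {As = As} {v} {ts} g = record
      { member  = embed-Spaced ts (desc g)
      ; below   = λ above → subst (_< v) (eval-sequences As ts) (below g (someBelow above))
      ; largest = λ { above w S w<v → largest′ above w (Spaced-embed w S) w<v }
      ; least   = λ { ¬above w S → least′ (¬above ∘ above) w (Spaced-embed w S) }
      }
      where
      someBelow : AboveInf As d N Δ v → SomeBelow (sequences As) v
      someBelow (w , S , w<v) with Spaced-embed w S
      ... | us , b , refl = us , b , subst (_< v) (sym (eval-sequences As us)) w<v
      above : SomeBelow (sequences As) v → AboveInf As d N Δ v
      above (us , b , us<v) = embed us , embed-Spaced us b , subst (_< v) (eval-sequences As us) us<v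
      largest′ : AboveInf As d N Δ v → ∀ w → (∃[ us ] Desc us × w ≡ embed us) → As · w < v →
                 As · w ≤ As · embed ts
      largest′ a _ (us , b , refl) us<v = subst₂ _≤_ (eval-sequences As us) (eval-sequences As ts)
        (largest g (someBelow a) us b (subst (_< v) (sym (eval-sequences As us)) us<v))
      least′ : ¬ SomeBelow (sequences As) v → ∀ w → (∃[ us ] Desc us × w ≡ embed us) →
               As · embed ts ≤ As · w
      least′ none _ (us , b , refl) = subst₂ _≤_ (eval-sequences As ts) (eval-sequences As us)
        (least g none us b)

    module _ (sparse : Sparse) where

      open OnSparse sparse using (D; r-sum)

      layer : ∀ {n ε O} {εs : Vec Bool n} {As} → Growth Δ ε O As →
              Layer ε εs (λ t → O ⟨ position (suc n) t ⟩) (sequences As)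
      layer {n} {ε} {O} {εs} {As} G = record
        { lex    = λ ts ts′ t<t′ b b′ → subst₂ (λ x y → sgn ε x < sgn ε y) (value ts) (value ts′)
            (lex (embed ts) (embed ts′) (position-mono-< (suc n) t<t′) (Below⇒Gapped ts b) (Below⇒Gapped ts′ b′))
        ; nonneg = nonneg ε sizes-pos
        ; K      = K
        ; double = double ε sizes-double
        }
        where
        open Growth G using (lex; lo; hi; lo≤Δ; lower; upper)
        F size : Seq
        F t = O ⟨ position (suc n) t ⟩
        size t = sgn ε (least-value εs F (sequences As) t)
        value : ∀ {t} ts → O ⟨ position (suc n) t ⟩ + As · embed ts ≡ F t + eval (sequences As) ts
        value ts = cong (_+_ (O ⟨ position (suc n) _ ⟩)) (sym (eval-sequences As ts))
        minimal : ℕ → Vec ℕ n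
        minimal t = extreme false εs t
        lower′ : ∀ t y → lo ℕ.+ y ℕ.≤ position (suc n) t → val y < size t
        lower′ t y le = subst (λ x → val y < sgn ε x) (value (minimal t))
          (lower y (embed (minimal t)) le (Below⇒Gapped (minimal t) (extreme-Below false εs t)))
        upper′ : ∀ t → size t ≤ val (hi ℕ.+ position (suc n) t)
        upper′ t = subst (λ x → sgn ε x ≤ val (hi ℕ.+ position (suc n) t)) (value (minimal t))
          (upper (embed (minimal t)) (Below⇒Gapped (minimal t) (extreme-Below false εs t)))
        sizes-pos : ∀ t → 0ℤ < size t
        sizes-pos t = ℤ.≤-<-trans (ℤ.+≤+ ℕ.z≤n) (lower′ t 0 (subst (ℕ._≤ _) (sym (ℕ.+-identityʳ lo))
          (ℕ.≤-trans lo≤Δ (Gapped⇒≥ (embed (minimal t)) (Below⇒Gapped (minimal t) (extreme-Below false εs t))))))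
        K : ℕ
        -- The sum of two upper bounds r (hi + p) is at most r (D + hi + hi + p), and lo further
        -- places bring the lower bound above it. A step of t moves the position by d ≥ 1 places, so
        -- K steps suffice.
        K = D ℕ.+ (hi ℕ.+ hi) ℕ.+ lo
        sizes-double : ∀ t → size t + size t < size (K ℕ.+ t)
        sizes-double t = ℤ.≤-<-trans (ℤ.+-mono-≤ (upper′ t) (upper′ t))
          (ℤ.≤-<-trans (ℤ.+≤+ (r-sum hi hi p)) (lower′ (K ℕ.+ t) _ far))
          where
          p : ℕ
          p = position (suc n) t
          rearrange : ∀ lo c p → lo ℕ.+ (c ℕ.+ p) ≡ p ℕ.+ (c ℕ.+ lo)
          rearrange = ℕ-solver.solve-∀
          rearrange′ : ∀ a N d k t → a ℕ.+ (N ℕ.+ d ℕ.* t) ℕ.+ d ℕ.* k ≡ a ℕ.+ (N ℕ.+ d ℕ.* (k ℕ.+ t))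
          rearrange′ = ℕ-solver.solve-∀
          far : lo ℕ.+ (D ℕ.+ (hi ℕ.+ hi) ℕ.+ p) ℕ.≤ position (suc n) (K ℕ.+ t)
          far = ℕ.≤-trans (ℕ.≤-reflexive (rearrange lo (D ℕ.+ (hi ℕ.+ hi)) p))
            (ℕ.≤-trans (ℕ.+-monoʳ-≤ p (ℕ.m≤n*m K d)) (ℕ.≤-reflexive (rearrange′ (suc n ℕ.* Δ) N d K t)))
        θ : Bool → Seq
        θ ε = threshold ε εs F (sequences As)
        nonneg : ∀ ε → (∀ t → 0ℤ < sgn ε (least-value εs F (sequences As) t)) → ∀ t → 0ℤ ≤ θ ε t
        nonneg true  h t = ℤ.<⇒≤ (h (suc t))
        nonneg false h t = ≤-difference (identity (- least-value εs F (sequences As) t)) (<⇒+1≤ (h t))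
          where
          identity : ∀ x → x - 1ℤ ≡ x - 1ℤ - 0ℤ
          identity = solve-∀
        double : ∀ ε → (∀ t → sgn ε (least-value εs F (sequences As) t) + sgn ε (least-value εs F (sequences As) t)
                           < sgn ε (least-value εs F (sequences As) (K ℕ.+ t))) →
                 ∀ t → θ ε t + θ ε t ≤ θ ε (K ℕ.+ t)
        double true  h t = subst (λ k → θ true t + θ true t ≤ least-value εs F (sequences As) k)
          (ℕ.+-suc K t) (ℤ.<⇒≤ (h (suc t)))
        double false h t = ℤ.≤-trans (ℤ.≤-reflexive (identity (- least-value εs F (sequences As) t)))
          (ℤ.+-mono-≤ (ℤ.<⇒≤ (h t)) (ℤ.-≤- {1} {0} ℕ.z≤n))
          where
          identity : ∀ x → (x - 1ℤ) + (x - 1ℤ) ≡ (x + x) + -[1+ 1 ]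
          identity = solve-∀

      layers : ∀ {n} {εs : Vec Bool n} {As} → Growths Δ εs As → Layers εs (sequences As)
      layers []       = []
      layers (G ∷ Gs) = layer G ∷ layers Gs

-- Isolating types over finite parameter sets

Pair : Set
Pair = Vec ℤ 2

TwoElements : List Pair → Set
TwoElements B = ∃[ b ] ∃[ b′ ] b ∈ B × b′ ∈ B × b ≢ b′

argmin : ∀ {Q : Pair → Set} → (∀ b → Dec (Q b)) → (f : Pair → ℤ) → ∀ B →
         (∀ {b} → b ∈ B → ¬ Q b) ⊎ (∃[ c ] c ∈ B × Q c × (∀ {b} → b ∈ B → Q b → f c ≤ f b))
argmin Q? f [] = inj₁ λ ()
argmin Q? f (b ∷ B) with Q? b | argmin Q? f B
... | no ¬q | inj₁ none = inj₁ λ { (here refl) → ¬q ; (there b∈B) → none b∈B }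
... | no ¬q | inj₂ (c , c∈B , q , min) =
  inj₂ (c , there c∈B , q , λ { (here refl) q′ → ⊥-elim (¬q q′) ; (there b∈B) → min b∈B })
... | yes q | inj₁ none =
  inj₂ (b , here refl , q , λ { (here refl) _ → ℤ.≤-refl ; (there b∈B) q′ → ⊥-elim (none b∈B q′) })
... | yes q | inj₂ (c , c∈B , q′ , min) with ℤ.≤-total (f b) (f c)
...   | inj₁ fb≤fc = inj₂ (b , here refl , q ,
          λ { (here refl) _ → ℤ.≤-refl ; (there b∈B) q″ → ℤ.≤-trans fb≤fc (min b∈B q″) })
...   | inj₂ fc≤fb = inj₂ (c , there c∈B , q′ , λ { (here refl) _ → fc≤fb ; (there b∈B) → min b∈B })

agrees-prefix : ∀ {l m n} {f : Fin m → Fin n} {ρ σ} → Agrees f ρ σ →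
                ∀ (u : Vec ℤ l) → Agrees (lift l f) (u ++ ρ) (u ++ σ)
agrees-prefix h []      i       = h i
agrees-prefix h (v ∷ u) zero    = refl
agrees-prefix h (v ∷ u) (suc i) = agrees-prefix h u i

leftPairs : ∀ j k → Fin (j ℕ.* 2) → Fin ((j ℕ.+ k) ℕ.* 2)
leftPairs (suc j) k = lift 2 (leftPairs j k)

rightPairs : ∀ j k → Fin (k ℕ.* 2) → Fin ((j ℕ.+ k) ℕ.* 2)
rightPairs zero    k i = i
rightPairs (suc j) k i = suc (suc (rightPairs j k i))

agrees-left : ∀ {j k} (c : Vec Pair j) (c′ : Vec Pair k) → Agrees (leftPairs j k) (concat c) (concat (c ++ c′))
agrees-left (b ∷ c) c′ = agrees-prefix (agrees-left c c′) b

agrees-right : ∀ {j k} (c : Vec Pair j) (c′ : Vec Pair k) → Agrees (rightPairs j k) (concat c′) (concat (c ++ c′))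
agrees-right []                c′ i = refl
agrees-right ((_ ∷ _ ∷ []) ∷ c) c′ i = agrees-right c c′ i

module Isolation {s : ℕ} (𝓜 : Structure s) where

  open Definability 𝓜

  -- Every a satisfies an instance ψ(x; u, c) with c from B, such that all
  -- solutions a′ of that instance stand in the relation ρ to a and B.
  Isolates : ∀ l → (Vec ℤ l → ℤ → ℤ → List Pair → Set) → Set
  Isolates l ρ = ∃[ k ] Σ[ ψ ∈ Formula s (suc (l ℕ.+ k ℕ.* 2)) ]
    (∀ u a B → TwoElements B → Σ[ c ∈ Vec Pair k ] All (_∈ B) c
      × (𝓜 ⊨ ψ [ a ∷ (u ++ concat c) ])
      × (∀ a′ → 𝓜 ⊨ ψ [ a′ ∷ (u ++ concat c) ] → ρ u a a′ B))

  module _ {l : ℕ} where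

    isolates-map : ∀ {ρ ρ′} → (∀ u a a′ B → TwoElements B → ρ u a a′ B → ρ′ u a a′ B) →
                   Isolates l ρ → Isolates l ρ′
    isolates-map h (k , ψ , iso) = k , ψ , λ u a B two →
      let c , c∈B , ψa , all = iso u a B two in c , c∈B , ψa , λ a′ ψa′ → h u a a′ B two (all a′ ψa′)

    infixr 6 _∧ⁱ_

    _∧ⁱ_ : ∀ {ρ ρ′} → Isolates l ρ → Isolates l ρ′ → Isolates l λ u a a′ B → ρ u a a′ B × ρ′ u a a′ B
    (j , ψ , iso) ∧ⁱ (k , χ , iso′) =
      j ℕ.+ k , rename (lift (suc l) (leftPairs j k)) ψ ∧̇ rename (lift (suc l) (rightPairs j k)) χ ,
      λ u a B two →
        let c  , c∈B  , ψa , all  = iso u a B two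
            c′ , c′∈B , χa , all′ = iso′ u a B two
            ψ-at a = ⊨-rename 𝓜 (agrees-prefix (agrees-left c c′) (a ∷ u)) ψ
            χ-at a = ⊨-rename 𝓜 (agrees-prefix (agrees-right c c′) (a ∷ u)) χ
        in c ++ c′ , ++⁺ c∈B c′∈B , (to (ψ-at a) ψa , to (χ-at a) χa) ,
           λ a′ (ψa′ , χa′) → all a′ (from (ψ-at a′) ψa′) , all′ a′ (from (χ-at a′) χa′)

    isolates-≤ : ∀ {ρ : ℕ → _} → (∀ i → Isolates l (ρ i)) → ∀ K →
                 Isolates l λ u a a′ B → ∀ i → i ℕ.≤ K → ρ i u a a′ B
    isolates-≤ h zero    = isolates-map (λ { u a a′ B _ p zero _ → p }) (h 0)
    isolates-≤ {ρ} h (suc K) = isolates-map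
      (λ u a a′ B _ (p , q) i i≤ → cases u a a′ B p q i (ℕ.m≤n⇒m<n∨m≡n i≤)) (h (suc K) ∧ⁱ isolates-≤ h K)
      where
      cases : ∀ u a a′ B → ρ (suc K) u a a′ B → (∀ i → i ℕ.≤ K → ρ i u a a′ B) →
              ∀ i → (i ℕ.< suc K) ⊎ (i ≡ suc K) → ρ i u a a′ B
      cases u a a′ B p q i (inj₁ i<) = q i (ℕ.s≤s⁻¹ i<)
      cases u a a′ B p q i (inj₂ refl) = p

    -- An element b of B may be chosen in dependence on a and B and then be treated as part of u; in
    -- the formula it becomes the first parameter. This is how the nearest point becomes available
    -- to later functions.
    isolates-bind : ∀ {ρ ρ′} → Isolates (2 ℕ.+ l) ρ′ →
      (∀ u a B → TwoElements B → ∃[ b ] b ∈ B × (∀ a′ → ρ′ (b ++ u) a a′ B → ρ u a a′ B)) →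
      Isolates l ρ
    isolates-bind (k , ψ , iso) choose = suc k , rename f ψ , λ u a B two →
      let b , b∈B , h = choose u a B two
          c , c∈B , ψa , all = iso (b ++ u) a B two
          ψ-at a = ⊨-rename 𝓜 (agrees b u c a) ψ
      in b ∷ c , b∈B ∷ c∈B , to (ψ-at a) ψa , λ a′ ψa′ → h a′ (all a′ (from (ψ-at a′) ψa′))
      where
      f : Fin (suc (2 ℕ.+ l ℕ.+ k ℕ.* 2)) → Fin (suc (l ℕ.+ (2 ℕ.+ k ℕ.* 2)))
      f zero                = zero
      f (suc zero)          = suc (l ↑ʳ zero)
      f (suc (suc zero))    = suc (l ↑ʳ suc zero)
      f (suc (suc (suc i))) = suc (lift l (2 ↑ʳ_) i)
      agrees : ∀ (b : Pair) u c a → Agrees f (a ∷ ((b ++ u) ++ concat c)) (a ∷ (u ++ (b ++ concat c)))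
      agrees b u c a zero = refl
      agrees (p ∷ q ∷ []) u c a (suc zero)          = lookup-++ʳ u (p ∷ q ∷ concat c) zero
      agrees (p ∷ q ∷ []) u c a (suc (suc zero))    = lookup-++ʳ u (p ∷ q ∷ concat c) (suc zero)
      agrees (p ∷ q ∷ []) u c a (suc (suc (suc i))) = agrees-prefix (λ _ → refl) u i

  -- Split functions f(x, u) + g(y, u)

  record Split (l : ℕ) : Set where
    constructor split
    field
      {fx} : Vec ℤ (suc l) → ℤ
      {fy} : Vec ℤ (2 ℕ.+ l) → ℤ
      dx   : DefFun id fx
      dy   : DefFun id fy

  open Split

  value : ∀ {l} → Split l → Vec ℤ l → ℤ → Pair → ℤ
  value S u x y = fx S (x ∷ u) + fy S (y ++ u)

  infixl 6 _⊞_ _⊟_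

  _⊞_ _⊟_ : ∀ {l} → Split l → Split l → Split l
  split dx dy ⊞ split dx′ dy′ = split (dx +ᵈ dx′) (dy +ᵈ dy′)
  split dx dy ⊟ split dx′ dy′ = split (dx -ᵈ dx′) (dy -ᵈ dy′)

  constantˢ : ∀ {l} → ℤ → Split l
  constantˢ c = split (constᵈ c) 0ᵈ

  sgnᵈ : ∀ {X : Set} {n} {e : X → Vec ℤ n} {f} ε → DefFun e f → DefFun e (λ x → sgn ε (f x))
  sgnᵈ true  d = d
  sgnᵈ false d = negᵈ d

  sgnˢ : ∀ {l} → Bool → Split l → Split l
  sgnˢ ε (split dx dy) = split (sgnᵈ ε dx) (sgnᵈ ε dy)

  module _ {l : ℕ} (u : Vec ℤ l) (x : ℤ) (y : Pair) where

    value-⊞ : ∀ S T → value (S ⊞ T) u x y ≡ value S u x y + value T u x y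
    value-⊞ S T = identity (fx S (x ∷ u)) (fx T (x ∷ u)) (fy S (y ++ u)) (fy T (y ++ u))
      where
      identity : ∀ a b c d → (a + b) + (c + d) ≡ (a + c) + (b + d)
      identity = solve-∀

    value-⊟ : ∀ S T → value (S ⊟ T) u x y ≡ value S u x y - value T u x y
    value-⊟ S T = identity (fx S (x ∷ u)) (fx T (x ∷ u)) (fy S (y ++ u)) (fy T (y ++ u))
      where
      identity : ∀ a b c d → (a - b) + (c - d) ≡ (a + c) - (b + d)
      identity = solve-∀

    value-sgn : ∀ ε S → value (sgnˢ ε S) u x y ≡ sgn ε (value S u x y)
    value-sgn ε S = sym (sgn-+ ε (fx S (x ∷ u)) (fy S (y ++ u)))

    value-constant : ∀ c → value (constantˢ c) u x y ≡ c
    value-constant c = ℤ.+-identityʳ c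

  Preserved : ∀ l → (Vec ℤ l → ℤ → Pair → Set) → Set
  Preserved l Φ = Isolates l λ u a a′ B → ∀ {b} → b ∈ B → Φ u a b ⇔ Φ u a′ b

  preserved-cong : ∀ {l Φ Φ′} → (∀ u x y → Φ u x y ⇔ Φ′ u x y) → Preserved l Φ → Preserved l Φ′
  preserved-cong h = isolates-map λ u a a′ B _ p b∈B → h u a′ _ ⇔-∘ (p b∈B ⇔-∘ ⇔-sym (h u a _))

  preserved-¬ : ∀ {l Φ} → Preserved l Φ → Preserved l λ u x y → ¬ Φ u x y
  preserved-¬ = isolates-map λ u a a′ B _ p {b} b∈B → →-cong-⇔ (p b∈B) (⇔-id _)

  module _ {l : ℕ} where

    private
      X : Set
      X = ℤ × Vec ℤ l × Vec ℤ 6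

      e : X → Vec ℤ (suc (l ℕ.+ 6))
      e (x , u , c) = x ∷ (u ++ c)

      uᵈ : ∀ i → DefFun e λ (x , u , c) → lookup u i
      uᵈ i = DefFun-cong (λ (x , u , c) → lookup-++ˡ u c i) (varᵈ (suc (i ↑ˡ 6)))

      cᵈ : ∀ i → DefFun e λ (x , u , c) → lookup c i
      cᵈ i = DefFun-cong (λ (x , u , c) → lookup-++ʳ u c i) (varᵈ (suc (l ↑ʳ i)))

    -- The parameter of least fy among those with 0 < value S u a b serves for
    -- all of them.  That there may be none is encoded by two distinct elements
    -- of B.
    positive-kept : ∀ (S : Split l) →
      Isolates l λ u a a′ B → ∀ {b} → b ∈ B → 0ℤ < value S u a b → 0ℤ < value S u a′ b
    positive-kept S = 3 , proj₁ ψ , isolate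
      where
      ψ : Def e λ (x , u , c) → lookup c 2F ≡ lookup c 4F × lookup c 3F ≡ lookup c 5F →
                                0ℤ < fx S (x ∷ u) + fy S (lookup c 0F ∷ lookup c 1F ∷ u)
      ψ = cᵈ 2F ≡ᵈ cᵈ 4F ∧ᵈ cᵈ 3F ≡ᵈ cᵈ 5F ⇒ᵈ
          0ᵈ <ᵈ compose (λ (x , u , c) → x ∷ u) (λ { zero → varᵈ zero ; (suc i) → uᵈ i }) (dx S)
                +ᵈ compose (λ (x , u , c) → lookup c 0F ∷ lookup c 1F ∷ u)
                     (λ { zero → cᵈ 0F ; (suc zero) → cᵈ 1F ; (suc (suc i)) → uᵈ i }) (dy S)
      same : (b b′ : Pair) → lookup b 0F ≡ lookup b′ 0F × lookup b 1F ≡ lookup b′ 1F → b ≡ b′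
      same (_ ∷ _ ∷ []) (_ ∷ _ ∷ []) (refl , refl) = refl
      ψ-at : ∀ x u (c b b′ : Pair) → (𝓜 ⊨ proj₁ ψ [ x ∷ (u ++ concat (c ∷ b ∷ b′ ∷ [])) ]) ⇔
             (b ≡ b′ → 0ℤ < value S u x c)
      ψ-at x u c@(_ ∷ _ ∷ []) b@(_ ∷ _ ∷ []) b′@(_ ∷ _ ∷ []) =
        mk⇔ (λ h → λ { refl → h (refl , refl) }) (λ h eq → h (same b b′ eq)) ⇔-∘
        proj₂ ψ (x , u , concat (c ∷ b ∷ b′ ∷ []))
      isolate : ∀ u a B → TwoElements B → Σ[ c ∈ Vec Pair 3 ] All (_∈ B) c
        × (𝓜 ⊨ proj₁ ψ [ a ∷ (u ++ concat c) ])
        × (∀ a′ → 𝓜 ⊨ proj₁ ψ [ a′ ∷ (u ++ concat c) ] →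
             ∀ {b} → b ∈ B → 0ℤ < value S u a b → 0ℤ < value S u a′ b)
      isolate u a B (b , b′ , b∈B , b′∈B , b≢b′)
        with argmin (λ b → 0ℤ ℤ.<? value S u a b) (λ b → fy S (b ++ u)) B
      ... | inj₁ none = b ∷ b ∷ b′ ∷ [] , b∈B ∷ b∈B ∷ b′∈B ∷ [] ,
            from (ψ-at a u b b b′) (⊥-elim ∘ b≢b′) , λ _ _ b∈B 0< → ⊥-elim (none b∈B 0<)
      ... | inj₂ (c , c∈B , 0<c , min) = c ∷ c ∷ c ∷ [] , c∈B ∷ c∈B ∷ c∈B ∷ [] ,
            from (ψ-at a u c c c) (λ _ → 0<c) ,
            λ a′ ψa′ b∈B 0< → ℤ.<-≤-trans (to (ψ-at a′ u c c c) ψa′ refl) (ℤ.+-monoʳ-≤ (fx S (a′ ∷ u)) (min b∈B 0<))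

    -- Over the integers, 0 < v fails exactly if 0 < 1 - v, so the converse is the preceding
    -- implication for 1 - S.
    positive-preserved : ∀ (S : Split l) → Preserved l λ u x y → 0ℤ < value S u x y
    positive-preserved S = isolates-map
      (λ u a a′ B _ (kept , kept′) {b} b∈B → mk⇔ (kept b∈B) (reflect u a a′ b (kept′ b∈B)))
      (positive-kept S ∧ⁱ positive-kept S′)
      where
      S′ : Split l
      S′ = constantˢ 1ℤ ⊟ S
      S′-value : ∀ u x y → value S′ u x y ≡ 1ℤ - value S u x y
      S′-value u x y = trans (value-⊟ u x y (constantˢ 1ℤ) S) (cong (_- value S u x y) (value-constant u x y 1ℤ))
      identity : ∀ v → (1ℤ - v) - 1ℤ ≡ 0ℤ - v
      identity = solve-∀
      reflect : ∀ u a a′ b → (0ℤ < value S′ u a b → 0ℤ < value S′ u a′ b) → 0ℤ < value S u a′ b → 0ℤ < value S u a b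
      reflect u a a′ b h 0<a′ with 0ℤ ℤ.<? value S u a b
      ... | yes 0<a = 0<a
      ... | no ¬0<a = ⊥-elim (ℤ.<⇒≱ 0<a′ (≤-difference (identity (value S u a′ b))
              (<⇒+1≤ (subst (0ℤ <_) (S′-value u a′ b) (h (subst (0ℤ <_) (sym (S′-value u a b))
                (+1≤⇒< (≤-difference (sym (identity (value S u a b))) (ℤ.≮⇒≥ ¬0<a)))))))))

  along : ∀ {m n f} (g : Vec ℤ m → Vec ℤ n) (h : Fin n → Fin m) →
          (∀ ρ → Agrees h (g ρ) ρ) → DefFun id f → DefFun id (f ∘ g)
  along g h agrees = reindex (λ (w , ρ) → w , g ρ) (lift 1 h)
    λ { (w , ρ) zero → refl ; (w , ρ) (suc i) → agrees ρ i }

  tailᵈ : ∀ {n f} → DefFun {X = Vec ℤ n} id f → DefFun {X = Vec ℤ (suc n)} id (f ∘ tail)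
  tailᵈ = along tail suc λ { (_ ∷ _) _ → refl }

  module _ {l : ℕ} where

    dropˣ : Vec ℤ (3 ℕ.+ l) → Vec ℤ (suc l)
    dropˣ (x ∷ _ ∷ _ ∷ u) = x ∷ u

    dropʸ : Vec ℤ (4 ℕ.+ l) → Vec ℤ (2 ℕ.+ l)
    dropʸ (y₁ ∷ y₂ ∷ _ ∷ _ ∷ u) = y₁ ∷ y₂ ∷ u

    dropˣᵈ : ∀ {f} → DefFun id f → DefFun id (f ∘ dropˣ)
    dropˣᵈ = along dropˣ (lift 1 (2 ↑ʳ_))
      λ { (_ ∷ _ ∷ _ ∷ _) zero → refl ; (_ ∷ _ ∷ _ ∷ _) (suc _) → refl }

    dropʸᵈ : ∀ {f} → DefFun id f → DefFun id (f ∘ dropʸ)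
    dropʸᵈ = along dropʸ (lift 2 (2 ↑ʳ_))
      λ { (_ ∷ _ ∷ _ ∷ _ ∷ _) zero → refl ; (_ ∷ _ ∷ _ ∷ _ ∷ _) (suc zero) → refl
        ; (_ ∷ _ ∷ _ ∷ _ ∷ _) (suc (suc _)) → refl }

    adjoin : Split l → Split (2 ℕ.+ l)
    adjoin (split dx dy) = split (dropˣᵈ dx) (dropʸᵈ dy)

    value-adjoin : ∀ S c u x y → value (adjoin S) (c ++ u) x y ≡ value S u x y
    value-adjoin S (_ ∷ _ ∷ []) u x (_ ∷ _ ∷ []) = refl

  -- Definability of the leading entry and induction on the length of the tuple

  module WithIndices (i₀ : Fin s) (e₀ : ℕ → ℤ) (e₀-mono : ∀ {t t′} → t ℕ.< t′ → e₀ t < e₀ t′)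
                     (range : ∀ v → lookup 𝓜 i₀ v ⇔ (∃[ t ] v ≡ e₀ t)) where

    open Indexed i₀ e₀ e₀-mono range

    DefSeq : Seq → Set
    DefSeq F = DefFun (λ t → e₀ t ∷ []) F

    infixl 8 _∘ᵈ_

    _∘ᵈ_ : ∀ {X : Set} {n} {e : X → Vec ℤ n} {F f} → DefSeq F → DefIndex e f → DefFun e (F ∘ f)
    _∘ᵈ_ {f = f} F d = compose f (λ { 0F → d }) F

    -- Entries of an extreme tuple equal t up to the first 0 and vanish from there on, so the part
    -- after that point is a constant.
    eval-extremeᵈ : ∀ {n} τ (εs : Vec Bool n) {Fs} → All DefSeq Fs → DefSeq λ t → eval Fs (extreme τ εs t)
    eval-extremeᵈ τ []       []       = 0ᵈ
    eval-extremeᵈ τ (ε ∷ εs) {F ∷ Fs} (d ∷ ds) = go τ ε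
      where
      go : ∀ τ′ ε → DefSeq λ t → F (pick τ′ ε t) + eval Fs (extreme τ εs (pick τ′ ε t))
      go true  true  = d +ᵈ eval-extremeᵈ τ εs ds
      go true  false = constᵈ (F 0 + eval Fs (extreme τ εs 0))
      go false true  = constᵈ (F 0 + eval Fs (extreme τ εs 0))
      go false false = d +ᵈ eval-extremeᵈ τ εs ds

    least-valueᵈ : ∀ {n} (εs : Vec Bool n) {F Fs} → DefSeq F → All DefSeq Fs → DefSeq (least-value εs F Fs)
    least-valueᵈ εs d ds = d +ᵈ eval-extremeᵈ false εs ds

    thresholdᵈ : ∀ {n} ε (εs : Vec Bool n) {F Fs} → DefSeq F → All DefSeq Fs → DefSeq (threshold ε εs F Fs)
    thresholdᵈ true  εs d ds = least-valueᵈ εs d ds ∘ᵈ sucⁱ (varᵈ 0F)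
    thresholdᵈ false εs d ds = negᵈ (least-valueᵈ εs d ds) -ᵈ 1ᵈ

    leadingᵈ : ∀ {n ε F} {εs : Vec Bool n} {Fs} (l : Layer ε εs F Fs) → DefSeq F → All DefSeq Fs →
               DefIndex (λ v → v ∷ []) (leading l)
    leadingᵈ {ε = ε} {F} {εs} {Fs} l d ds = fromGraph (Def-cong graph
      (¬ᵈ (θᵈ ∘ᵈ varⁱ <ᵈ sgnᵈ ε (varᵈ 1F)) ∧ᵈ ∀ⁱ (varⁱ <ⁱ varᵈ 1F ⇒ᵈ θᵈ ∘ᵈ varⁱ <ᵈ sgnᵈ ε (varᵈ 2F))))
      where
      θ : Seq
      θ = threshold ε εs F Fs
      θᵈ : DefSeq θ
      θᵈ = thresholdᵈ ε εs d ds
      graph : ∀ ((t , v) : ℕ × ℤ) → (¬ θ t < sgn ε v × (∀ t′ → t′ ℕ.< t → θ t′ < sgn ε v)) ⇔ (t ≡ leading l v)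
      graph (t , v) = mk⇔
        (λ (≮ , t-least) → ℕ.≤-antisym
          (ℕ.≮⇒≥ λ log<t → ℤ.<⇒≱ (t-least _ log<t) (≤-θ-log l (sgn ε v)))
          (log-≤ l (sgn ε v) (ℤ.≮⇒≥ ≮)))
        (λ { refl → (λ θ<v → ℤ.<⇒≱ θ<v (≤-θ-log l (sgn ε v))) , λ t′ → θ-<-log l (sgn ε v) })

    -- For an index depending on both x and y, F of the index need not be a split function. With one
    -- of the two dependences it always is, with 0 as the other summand.
    data SplitIndex (l : ℕ) : Set where
      ofˣ : (f : Vec ℤ (suc l) → ℕ) → DefIndex id f → SplitIndex l
      ofʸ : (f : Vec ℤ (2 ℕ.+ l) → ℕ) → DefIndex id f → SplitIndex l

    index : ∀ {l} → SplitIndex l → Vec ℤ l → ℤ → Pair → ℕ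
    index (ofˣ f _) u x y = f (x ∷ u)
    index (ofʸ f _) u x y = f (y ++ u)

    apply : ∀ {l F} → DefSeq F → SplitIndex l → Split l
    apply d (ofˣ f df) = split (d ∘ᵈ df) 0ᵈ
    apply d (ofʸ f df) = split 0ᵈ (d ∘ᵈ df)

    value-apply : ∀ {l F} (d : DefSeq F) (z : SplitIndex l) u x y → value (apply d z) u x y ≡ F (index z u x y)
    value-apply d (ofˣ f df) u x y = ℤ.+-identityʳ _
    value-apply d (ofʸ f df) u x y = ℤ.+-identityˡ _

    predˢ : ∀ {l} → SplitIndex l → SplitIndex l
    predˢ (ofˣ f d) = ofˣ _ (predⁱ d)
    predˢ (ofʸ f d) = ofʸ _ (predⁱ d)

    index-pred : ∀ {l} (z : SplitIndex l) u x y → index (predˢ z) u x y ≡ ℕ.pred (index z u x y)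
    index-pred (ofˣ f d) u x y = refl
    index-pred (ofʸ f d) u x y = refl

    module _ {n ε F} {εs : Vec Bool n} {Fs} {B} {Bs : Vec Seq n} (L : Layer ε εs F Fs) (Ls : Layers εs Fs)
             (F-def : DefSeq F) (Fs-def : All DefSeq Fs) (B-def : DefSeq B) (Bs-def : All DefSeq Bs)
             (IH : ∀ {l} (V T : Split l) →
                   Preserved l λ u x y → 0ℤ < value T u x y + eval Bs (P Ls (value V u x y))) where

      private
        θ : Seq
        θ = threshold ε εs F Fs

        θ-def : DefSeq θ
        θ-def = thresholdᵈ ε εs F-def Fs-def

        top : Vec Seq n → Seq
        top Gs t = eval Gs (extreme true εs t)

      Φ : ∀ {l} → Split l → Split l → Vec ℤ l → ℤ → Pair → Set
      Φ V T u x y = 0ℤ < value T u x y + eval (B ∷ Bs) (P (L ∷ Ls) (value V u x y))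

      private
        P-sat : ∀ {v t z} → leading L v ≡ z → Saturated εs F Fs v z →
                (0ℤ < t + eval (B ∷ Bs) (P (L ∷ Ls) v)) ⇔ (0ℤ < t + (B z + top Bs z))
        P-sat {v} {t} eq s = ≡⇒⇔ (cong (λ ts → 0ℤ < t + eval (B ∷ Bs) ts) (P-saturated L Ls v eq s))

        P-unsat : ∀ {v t z} → leading L v ≡ z → ¬ Saturated εs F Fs v z →
                  (0ℤ < t + eval (B ∷ Bs) (P (L ∷ Ls) v)) ⇔ (0ℤ < (t + B z) + eval Bs (P Ls (v - F z)))
        P-unsat {v} {t} {z} eq ¬s = ≡⇒⇔ (trans (cong (λ ts → 0ℤ < t + eval (B ∷ Bs) ts) (P-unsaturated L Ls v eq ¬s))
          (cong (0ℤ <_) (sym (ℤ.+-assoc t (B z) _))))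

        -- The first three equivalences carry over that z is the leading entry, the second and
        -- fourth decide saturation, and the last two settle the truth value in the saturated and
        -- the unsaturated case.
        transfer : ∀ {v v′ t t′ z z′} →
          (sgn ε v ≤ θ z) ⇔ (sgn ε v′ ≤ θ z′) →
          (z ≡ 0) ⇔ (z′ ≡ 0) →
          (θ (ℕ.pred z) < sgn ε v) ⇔ (θ (ℕ.pred z′) < sgn ε v′) →
          (F z + top Fs z < v) ⇔ (F z′ + top Fs z′ < v′) →
          (0ℤ < t + (B z + top Bs z)) ⇔ (0ℤ < t′ + (B z′ + top Bs z′)) →
          (0ℤ < (t + B z) + eval Bs (P Ls (v - F z))) ⇔ (0ℤ < (t′ + B z′) + eval Bs (P Ls (v′ - F z′))) →
          leading L v ≡ z →
          (0ℤ < t + eval (B ∷ Bs) (P (L ∷ Ls) v)) ⇔ (0ℤ < t′ + eval (B ∷ Bs) (P (L ∷ Ls) v′))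
        transfer {v} {v′} {t} {t′} {z} {z′} h₁ h₂ h₃ h₄ h₅ h₆ eq with saturated? εs F Fs v z
        ... | yes s = ⇔-sym (P-sat {t = t′} eq′ (to (h₂ ⊎-⇔ h₄) s)) ⇔-∘ (h₅ ⇔-∘ P-sat {t = t} eq s)
          where
          eq′ : leading L v′ ≡ z′
          eq′ = let ≤θ , >θ = log-unique⁻¹ L (sgn ε v) eq in log-unique L (sgn ε v′) (to h₁ ≤θ) (to (h₂ ⊎-⇔ h₃) >θ)
        ... | no ¬s = ⇔-sym (P-unsat {t = t′} eq′ (¬s ∘ from (h₂ ⊎-⇔ h₄))) ⇔-∘ (h₆ ⇔-∘ P-unsat {t = t} eq ¬s)
          where
          eq′ : leading L v′ ≡ z′
          eq′ = let ≤θ , >θ = log-unique⁻¹ L (sgn ε v) eq in log-unique L (sgn ε v′) (to h₁ ≤θ) (to (h₂ ⊎-⇔ h₃) >θ)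

      -- If z is the leading entry for V, this fact and the truth of Φ are
      -- decided by signs of split functions and by tuples with one entry less.
      preserved-leading : ∀ {l} (V T : Split l) (z : SplitIndex l) → Isolates l λ u a a′ C →
        ∀ {b} → b ∈ C → leading L (value V u a b) ≡ index z u a b → Φ V T u a b ⇔ Φ V T u a′ b
      preserved-leading {l} V T z = isolates-map
        (λ u a a′ C _ (h₁ , h₂ , h₃ , h₄ , h₅ , h₆) {b} b∈C →
          transfer {t = value T u a b} {value T u a′ b} (h₁ b∈C) (h₂ b∈C) (h₃ b∈C) (h₄ b∈C) (h₅ b∈C) (h₆ b∈C))
        (p₁ ∧ⁱ p₂ ∧ⁱ p₃ ∧ⁱ p₄ ∧ⁱ p₅ ∧ⁱ p₆)
        where
        positive : (S : Split l) {g : Vec ℤ l → ℤ → Pair → ℤ} → (∀ u x y → value S u x y ≡ g u x y) →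
                   Preserved l λ u x y → 0ℤ < g u x y
        positive S h = preserved-cong (λ u x y → ≡⇒⇔ (cong (0ℤ <_) (h u x y))) (positive-preserved S)

        p₁ : Preserved l λ u x y → sgn ε (value V u x y) ≤ θ (index z u x y)
        p₁ = preserved-cong
          (λ u x y → let θz = θ (index z u x y) ; v = sgn ε (value V u x y) in
            mk⇔ (λ h → ≤-difference (identity θz v) (<⇒+1≤ h)) (λ h → +1≤⇒< (≤-difference (sym (identity θz v)) h)))
          (positive (constantˢ 1ℤ ⊞ (apply θ-def z ⊟ sgnˢ ε V)) λ u x y →
            trans (value-⊞ u x y (constantˢ 1ℤ) (apply θ-def z ⊟ sgnˢ ε V))
            (cong₂ _+_ (value-constant u x y 1ℤ) (trans (value-⊟ u x y (apply θ-def z) (sgnˢ ε V))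
              (cong₂ _-_ (value-apply θ-def z u x y) (value-sgn u x y ε V)))))
          where
          identity : ∀ a b → (1ℤ + (a - b)) - (0ℤ + 1ℤ) ≡ a - b
          identity = solve-∀

        <-preserved : (S S′ : Split l) {g g′ : Vec ℤ l → ℤ → Pair → ℤ} →
                      (∀ u x y → value S u x y ≡ g u x y) → (∀ u x y → value S′ u x y ≡ g′ u x y) →
                      Preserved l λ u x y → g u x y < g′ u x y
        <-preserved S S′ {g} {g′} h h′ = preserved-cong
          (λ u x y → let eq = ℤ.+-identityʳ (g′ u x y - g u x y) in mk⇔ (<-difference eq) (<-difference (sym eq)))
          (positive (S′ ⊟ S) λ u x y → trans (value-⊟ u x y S′ S) (cong₂ _-_ (h′ u x y) (h u x y)))

        p₂ : Preserved l λ u x y → index z u x y ≡ 0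
        p₂ = preserved-cong
          (λ u x y → mk⇔ (λ ≮ → ℕ.n≤0⇒n≡0 (ℕ.≮⇒≥ (≮ ∘ e₀-mono))) (λ z≡0 lt → ℕ.<-irrefl (sym z≡0) (e₀-reflects lt)))
          (preserved-¬ (<-preserved (constantˢ (e₀ 0)) (apply (varᵈ 0F) z)
            (λ u x y → value-constant u x y (e₀ 0)) (value-apply (varᵈ 0F) z)))

        p₃ : Preserved l λ u x y → θ (ℕ.pred (index z u x y)) < sgn ε (value V u x y)
        p₃ = <-preserved (apply θ-def (predˢ z)) (sgnˢ ε V)
          (λ u x y → trans (value-apply θ-def (predˢ z) u x y) (cong θ (index-pred z u x y)))
          (λ u x y → value-sgn u x y ε V)

        p₄ : Preserved l λ u x y → F (index z u x y) + top Fs (index z u x y) < value V u x y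
        p₄ = <-preserved (apply d z) V (value-apply d z) (λ _ _ _ → refl)
          where
          d : DefSeq λ t → F t + top Fs t
          d = F-def +ᵈ eval-extremeᵈ true εs Fs-def

        p₅ : Preserved l λ u x y → 0ℤ < value T u x y + (B (index z u x y) + top Bs (index z u x y))
        p₅ = positive (T ⊞ apply d z) λ u x y →
            trans (value-⊞ u x y T (apply d z)) (cong (_+_ (value T u x y)) (value-apply d z u x y))
          where
          d : DefSeq λ t → B t + top Bs t
          d = B-def +ᵈ eval-extremeᵈ true εs Bs-def

        -- The first entry is absorbed by moving F z into V and B z into T. Both remain split
        -- because z depends on x or on y alone.
        p₆ : Preserved l λ u x y → 0ℤ < (value T u x y + B (index z u x y)) +
                                        eval Bs (P Ls (value V u x y - F (index z u x y)))
        p₆ = preserved-cong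
          (λ u x y → ≡⇒⇔ (cong₂ (λ t v → 0ℤ < t + eval Bs (P Ls v))
            (trans (value-⊞ u x y T (apply B-def z)) (cong (_+_ (value T u x y)) (value-apply B-def z u x y)))
            (trans (value-⊟ u x y V (apply F-def z)) (cong (_-_ (value V u x y)) (value-apply F-def z u x y)))))
          (IH (V ⊟ apply F-def z) (T ⊞ apply B-def z))

      module _ {l : ℕ} (V T : Split l) where

        private
          -- The chosen parameter c occupies the first two places of the new u. Then `hˣ` is V(x,
          -- c), and `hʸ` below is the difference of the y-parts of V at y and at c.
          hˣ : Vec ℤ (3 ℕ.+ l) → ℤ
          hˣ ρ = fx V (dropˣ ρ) + fy V (tail ρ)

          hʸ : Vec ℤ (4 ℕ.+ l) → ℤ
          hʸ ρ = fy V (dropʸ ρ) - fy V (tail (tail ρ))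

          leading∘ᵈ : ∀ {n} {h : Vec ℤ n → ℤ} i → DefFun id h → DefIndex id λ ρ → i ℕ.+ leading L (h ρ)
          leading∘ᵈ {h = h} i d = addⁱ i (compose h (λ { 0F → d }) (leadingᵈ L F-def Fs-def))

          zˣ zʸ : ℕ → SplitIndex (2 ℕ.+ l)
          zˣ i = ofˣ (λ ρ → i ℕ.+ leading L (hˣ ρ)) (leading∘ᵈ {h = hˣ} i (dropˣᵈ (dx V) +ᵈ tailᵈ (dy V)))
          zʸ i = ofʸ (λ ρ → i ℕ.+ leading L (hʸ ρ)) (leading∘ᵈ {h = hʸ} i (dropʸᵈ (dy V) -ᵈ tailᵈ (tailᵈ (dy V))))

        -- For c extremal, V(a, b) = V(a, c) + (fy b - fy c) is a sum of two
        -- numbers of the same sign, the first depending on a only and the second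
        -- on b only; one of them determines the leading entry for V(a, b).
        preserved-side : ∀ τ → Isolates l λ u a a′ C →
          ∀ {b} → b ∈ C → 0ℤ ≤ sgn τ (value V u a b) → Φ V T u a b ⇔ Φ V T u a′ b
        preserved-side τ = isolates-bind
          (isolates-≤ (λ i → preserved-leading (adjoin V) (adjoin T) (zˣ i) ∧ⁱ
                             preserved-leading (adjoin V) (adjoin T) (zʸ i)) (Layer.K L))
          choose
          where
          -- The correct candidate varies with b, so all of them are treated at once, each under the
          -- premise that it gives the leading entry at b.
          Candidates : Vec ℤ (2 ℕ.+ l) → ℤ → ℤ → List Pair → Set
          Candidates u a a′ C = ∀ i → i ℕ.≤ Layer.K L →
            (∀ {b} → b ∈ C → leading L (value (adjoin V) u a b) ≡ index (zˣ i) u a b →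
                             Φ (adjoin V) (adjoin T) u a b ⇔ Φ (adjoin V) (adjoin T) u a′ b) ×
            (∀ {b} → b ∈ C → leading L (value (adjoin V) u a b) ≡ index (zʸ i) u a b →
                             Φ (adjoin V) (adjoin T) u a b ⇔ Φ (adjoin V) (adjoin T) u a′ b)

          Φ-adjoin : ∀ c u a b → Φ (adjoin V) (adjoin T) (c ++ u) a b ⇔ Φ V T u a b
          Φ-adjoin c u a b = ≡⇒⇔ (cong₂ (λ v t → 0ℤ < t + eval (B ∷ Bs) (P (L ∷ Ls) v))
            (value-adjoin V c u a b) (value-adjoin T c u a b))

          use : ∀ c u a a′ C {b} → Candidates (c ++ u) a a′ C → b ∈ C → 0ℤ ≤ sgn τ (value V u a c) →
                sgn τ (fy V (c ++ u)) ≤ sgn τ (fy V (b ++ u)) → Φ V T u a b ⇔ Φ V T u a′ b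
          use c@(_ ∷ _ ∷ []) u a a′ C {b@(_ ∷ _ ∷ [])} h b∈C 0≤ c≤b =
            Φ-adjoin c u a′ b ⇔-∘ (by-candidate (leading-+ L τ 0≤ (sgn-difference τ c≤b)) ⇔-∘ ⇔-sym (Φ-adjoin c u a b))
            where
            v w : ℤ
            v = value V u a c
            w = fy V (b ++ u) - fy V (c ++ u)
            v+w : value V u a b ≡ v + w
            v+w = identity (fx V (a ∷ u)) (fy V (b ++ u)) (fy V (c ++ u))
              where
              identity : ∀ x y z → x + y ≡ (x + z) + (y - z)
              identity = solve-∀
            by-candidate : (∃[ i ] i ℕ.≤ Layer.K L × ((leading L (v + w) ≡ i ℕ.+ leading L v) ⊎
                                                      (leading L (v + w) ≡ i ℕ.+ leading L w))) →
                           Φ (adjoin V) (adjoin T) (c ++ u) a b ⇔ Φ (adjoin V) (adjoin T) (c ++ u) a′ b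
            by-candidate (i , i≤K , inj₁ eq) = proj₁ (h i i≤K) b∈C (trans (cong (leading L) v+w) eq)
            by-candidate (i , i≤K , inj₂ eq) = proj₂ (h i i≤K) b∈C (trans (cong (leading L) v+w) eq)

          choose : ∀ u a C → TwoElements C → ∃[ c ] c ∈ C × (∀ a′ → Candidates (c ++ u) a a′ C →
            ∀ {b} → b ∈ C → 0ℤ ≤ sgn τ (value V u a b) → Φ V T u a b ⇔ Φ V T u a′ b)
          choose u a C (b , _ , b∈C , _)
            with argmin (λ b → 0ℤ ℤ.≤? sgn τ (value V u a b)) (λ b → sgn τ (fy V (b ++ u))) C
          -- With no element on this side the claim is vacuous, and any b serves as the parameter.
          ... | inj₁ none = b , b∈C , λ _ _ b∈C 0≤ → ⊥-elim (none b∈C 0≤)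
          ... | inj₂ (c , c∈C , 0≤ , min) = c , c∈C , λ a′ h b∈C 0≤b → use c u a a′ C h b∈C 0≤ (min b∈C 0≤b)

        preserved-step : Preserved l (Φ V T)
        preserved-step = isolates-map
          (λ u a a′ C _ (h⁺ , h⁻) {b} b∈C → either (value V u a b) (h⁺ b∈C) (h⁻ b∈C))
          (preserved-side true ∧ⁱ preserved-side false)
          where
          either : ∀ {Q : Set} v → (0ℤ ≤ v → Q) → (0ℤ ≤ - v → Q) → Q
          either v h⁺ h⁻ with ℤ.≤-total 0ℤ v
          ... | inj₁ 0≤v = h⁺ 0≤v
          ... | inj₂ v≤0 = h⁻ (ℤ.neg-mono-≤ v≤0)

    -- All l, V and T must be allowed: each step adds a pair to u and changes both V and T.
    preserved-P : ∀ {n} {εs : Vec Bool n} {Fs Bs} (Ls : Layers εs Fs) → All DefSeq Fs → All DefSeq Bs →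
                  ∀ {l} (V T : Split l) →
                  Preserved l λ u x y → 0ℤ < value T u x y + eval Bs (P Ls (value V u x y))
    preserved-P {Bs = []} [] [] [] V T = preserved-cong
      (λ u x y → ≡⇒⇔ (cong (0ℤ <_) (sym (ℤ.+-identityʳ (value T u x y))))) (positive-preserved T)
    preserved-P {Bs = _ ∷ _} (L ∷ Ls) (F-def ∷ Fs-def) (B-def ∷ Bs-def) =
      preserved-step L Ls F-def Fs-def B-def Bs-def (preserved-P Ls Fs-def Bs-def)

  strongHonestDefinition : {φ : Vec ℤ 1 → Vec ℤ 2 → Set} → Preserved 0 (λ _ x y → φ (x ∷ []) y) →
                           HasStrongHonestDefinition 𝓜 φ
  strongHonestDefinition (k , ψ , iso) = k , ψ , λ { (a ∷ []) B two →
    let c , c∈B , ψa , h = iso [] a B two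
    in c , (λ i → lookup⁺ c∈B i) , ψa , λ { (a′ ∷ []) ψa′ b b∈B → h a′ ψa′ b∈B } }

replace-strongHonestDefinition :
  ∀ {s s′ p q} (𝓜 : Structure s) (𝓝 : Structure s′) (θ : Fin s → Formula s′ 1) →
  (∀ i v → (𝓝 ⊨ θ i [ v ∷ [] ]) ⇔ lookup 𝓜 i v) → {φ : Vec ℤ p → Vec ℤ q → Set} →
  HasStrongHonestDefinition 𝓜 φ → HasStrongHonestDefinition 𝓝 φ
replace-strongHonestDefinition 𝓜 𝓝 θ θ-def (k , ψ , h) = k , replace θ ψ , λ a B two →
  let c , c∈B , ψa , all = h a B two in
  c , c∈B , to (at (a ++ concat c)) ψa , λ a′ ψa′ → all a′ (from (at (a′ ++ concat c)) ψa′)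
  where
  at : ∀ ρ → (𝓜 ⊨ ψ [ ρ ]) ⇔ (𝓝 ⊨ replace θ ψ [ ρ ])
  at = ⊨-replace 𝓜 𝓝 θ θ-def ψ

-- Application to operators on R

module _ (R : Pred ℕ 0ℓ) (r : ℕ → ℕ) (enum : IncreasingEnumeration R r) (d N : ℕ) .{{_ : NonZero d}} where

  open IncreasingEnumeration enum
  open OnPredicate r
  open Growing r increasing

  -- Entries of tuples are indexed along R̃, while operators apply the successor of R; hence both
  -- predicates.
  𝓜₂ : Structure 2
  𝓜₂ = inℤ R ∷ inℤ (Sub d N) ∷ []

  open Definability 𝓜₂
  open Isolation 𝓜₂

  range-R : ∀ v → inℤ R v ⇔ (∃[ z ] v ≡ val z)
  range-R v = mk⇔
    (λ (z , Rz , v≡) → let n , z≡ = complete Rz in n , trans v≡ (cong +_ z≡))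
    (λ (n , v≡) → r n , sound n , v≡)

  element : ℕ → ℤ
  element t = val (N ℕ.+ d ℕ.* t)

  range-R̃ : ∀ v → inℤ (Sub d N) v ⇔ (∃[ t ] v ≡ element t)
  range-R̃ v = mk⇔
    (λ (z , (t , z≡) , v≡) → t , trans v≡ (cong +_ z≡))
    (λ (t , v≡) → _ , (t , refl) , v≡)

  element-mono : ∀ {s t} → s ℕ.< t → element s < element t
  element-mono s<t = ℤ.+<+ (r-mono-< (ℕ.+-monoʳ-< N (ℕ.*-monoʳ-< d s<t)))

  open Indexed 0F val (ℤ.+<+ ∘ r-mono-<) range-R using (DefIndex; sucⁱ; addⁱ)
  open WithIndices 1F element element-mono range-R̃ using (DefSeq; preserved-P)

  operatorᵈ : ∀ {X : Set} {n} {e : X → Vec ℤ n} {f} O → DefIndex e f → DefFun e λ x → O ⟨ f x ⟩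
  operatorᵈ []       f-def = 0ᵈ
  operatorᵈ (a ∷ as) f-def = a *ᵈ f-def +ᵈ operatorᵈ as (sucⁱ f-def)

  module _ (δ : ℕ) where

    open Grid d N δ

    sequences-def : ∀ {n} (As : Vec Operator n) → All DefSeq (sequences As)
    sequences-def []               = []
    sequences-def {suc n} (O ∷ As) =
      -- The coordinate `element t` stands for the index t in R̃ and also for the index N + d t in
      -- R, so the variable itself represents the latter.
      operatorᵈ O (addⁱ {f = λ t → N ℕ.+ d ℕ.* t} (suc n ℕ.* Δ) (varᵈ 0F)) ∷ sequences-def As

    formula-preserved : ∀ {n} {εs : Vec Bool n} {As} (Ls : Layers εs (sequences As)) (B : Vec Operator n) □ E →
      Preserved 0 λ _ x y → formula E □ B (embed ∘ P Ls) (x ∷ []) y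
    formula-preserved {n} Ls B □ E = go □
      where
      V : Split 0
      V = split (varᵈ 0F) (negᵈ (varᵈ 0F))
      -- With w the value of 𝐁 · P, k = 0 makes the sum w - (Ex - y₂), positive exactly for <. With
      -- k = 1 it is positive exactly if Ex - y₂ ≤ w, the negation of >.
      T : ℤ → Split 0
      T k = split (negᵈ ((+ toℕ E) *ᵈ varᵈ 0F)) (varᵈ 1F +ᵈ constᵈ k)
      e : ℤ
      e = + toℕ E
      preserved : ∀ k → Preserved 0 λ u x y → 0ℤ < value (T k) u x y + eval (sequences B) (P Ls (value V u x y))
      preserved k = preserved-P Ls (sequences-def _) (sequences-def B) V (T k)

      identity₀ : ∀ x y w → (- x + (y + 0ℤ) + w) - 0ℤ ≡ w - (x - y)
      identity₀ = solve-∀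
      identity₁ : ∀ x y w → (- x + (y + 1ℤ) + w) - (0ℤ + 1ℤ) ≡ w - (x - y)
      identity₁ = solve-∀

      less-⇔ : ∀ x y w → (0ℤ < - x + (y + 0ℤ) + w) ⇔ (x - y < w)
      less-⇔ x y w = mk⇔ (<-difference (identity₀ x y w)) (<-difference (sym (identity₀ x y w)))

      greater-⇔ : ∀ x y w → (¬ 0ℤ < - x + (y + 1ℤ) + w) ⇔ (w < x - y)
      greater-⇔ x y w = mk⇔
        (λ h → ℤ.≰⇒> λ le → h (+1≤⇒< (≤-difference (sym (identity₁ x y w)) le)))
        (λ lt 0< → ℤ.<⇒≱ lt (≤-difference (identity₁ x y w) (<⇒+1≤ 0<)))

      go : ∀ □ → Preserved 0 λ _ x y → formula E □ B (embed ∘ P Ls) (x ∷ []) y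
      go less = preserved-cong (λ { [] x (y₁ ∷ y₂ ∷ []) →
        subst (λ w → (0ℤ < value (T 0ℤ) [] x (y₁ ∷ y₂ ∷ []) + eval (sequences B) (P Ls (x - y₁))) ⇔ (e * x - y₂ < w))
          (eval-sequences B (P Ls (x - y₁))) (less-⇔ (e * x) y₂ _) }) (preserved 0ℤ)
      go greater = preserved-cong (λ { [] x (y₁ ∷ y₂ ∷ []) →
        subst (λ w → (¬ 0ℤ < value (T 1ℤ) [] x (y₁ ∷ y₂ ∷ []) + eval (sequences B) (P Ls (x - y₁))) ⇔ (w < e * x - y₂))
          (eval-sequences B (P Ls (x - y₁))) (greater-⇔ (e * x) y₂ _) }) (preserved-¬ (preserved 1ℤ))

mainTheorem20 : (R : Pred ℕ 0ℓ) (r : ℕ → ℕ) → IncreasingEnumeration R r →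
    let open OnPredicate r in
    Sparse → CongruencePeriodic →
    ∀ (n : ℕ) .{{_ : NonZero n}} (d : ℕ) .{{_ : NonZero d}} (N : ℕ) →
    let R̃ = Sub d N in
    ∀ (A : Vec Operator n) → (∀ i → ¬ (lookup A i =R0)) →
    ∀ (B : Vec Operator n) (□ : Comparison) (E : Fin 2) →
    (E ≡ 1F ⊎ (∃[ i ] B ≋ 𝐅 i)) →
    ∃[ Δ₀ ] ∀ (Δ : ℕ) → d ∣ Δ → Δ₀ ℕ.≤ Δ →
    InjectiveOnSpaced A Δ
    × Σ[ P ∈ (ℤ → Vec Elem n) ]
    (∀ x → IsP A d N Δ x (P x))
    × (Definable (inℤ R ∷ []) (inℤ R̃) →
    HasStrongHonestDefinition (inℤ R ∷ []) (formula E □ B P))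
    × HasStrongHonestDefinition (inℤ R ∷ inℤ R̃ ∷ []) (formula E □ B P)
mainTheorem20 R r enum sparse _ n d N A A≠0 B □ E _ =
  let open Growing r (IncreasingEnumeration.increasing enum)
      εs , Δ₀ , growth = growths sparse A A≠0
  in Δ₀ , λ { _ (divides δ refl) Δ₀≤Δ →
    let open Grid d N δ
        Gs  = growth Δ Δ₀≤Δ
        Ls  = layers sparse Gs
        shd = Isolation.strongHonestDefinition (𝓜₂ R r enum d N) (formula-preserved R r enum d N δ Ls B □ E)
    in (λ z z′ S S′ → ·-injective Gs z z′ (Spaced⇒Chain z S) (Spaced⇒Chain z′ S′)) ,
       embed ∘ P Ls , (λ v → IsP-embed (P-greatest Ls v)) ,
       (λ (θ , θ-def) → replace-strongHonestDefinition (𝓜₂ R r enum d N) (inℤ R ∷ [])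
          (λ { 0F → pred 0F (var 0F) ; 1F → θ }) (λ { 0F v → ⇔-id _ ; 1F v → θ-def v }) shd) ,
       shd }
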